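{- Each of the two non-abelian groups of order $27$ has both a narcissistic terrace and a directed half-and-half terrace. The non-abelian group of order $39$ has a directed half-and-half terrace.
   Context: Let $G$ be a finite group of odd order $n$ and $\mathbf{a}=(a_1,\dots,a_n)$ an arrangement of its elements, with $b_i = a_i^{ -1}a_{i+1}$ for $1\le i \le n-1$. Since $n$ is odd, $G$ has no involutions; $\mathbf{a}$ is a terrace if for each $x \ne e$ the elements $x$ and $x^{ -1}$ together occur exactly twice in $(b_1,\dots,b_{n-1})$, and a directed terrace if the $b_i$ are pairwise distinct. A terrace $\mathbf{a}$ is half-and-half if for each set $\{g,g^{ -1}\}$ with $g\ne e$ exactly one element occurrence from that set lies in $(b_1,\dots,b_{(n-1)/2})$ (and hence exactly one lies in $(b_{(n+1)/2},\dots,b_{n-1})$). A terrace is narcissistic if the sequence $(b_1,\dots,b_{n-1})$ equals its reverse. A directed half-and-half terrace is a directed terrace that is half-and-half. There is a unique non-abelian group of order 39 up to isomorphism. -}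

module Defs where

open import Algebra.Bundles using (Group)
open import Algebra.Definitions using (Commutative)
open import Data.Fin.Base using (Fin; suc; toℕ; inject₁; opposite)
open import Data.Nat.Base using (ℕ; suc; _<_; ⌊_/2⌋)
open import Data.Product.Base using (∃-syntax; _×_)
open import Data.Product using (∃!)
open import Data.Sum.Base using (_⊎_)
open import Function.Bundles using (Bijection)
open import Function.Definitions using (Injective)
open import Level using (Level; _⊔_)
open import Relation.Binary.PropositionalEquality.Core using (_≡_; _≢_)
open import Relation.Binary.PropositionalEquality.Properties using () renaming (setoid to ≡-setoid)
open import Relation.Nullary.Negation.Core using (¬_)

ExactlyTwo : ∀ {p} {k : ℕ} → (Fin k → Set p) → Set p
ExactlyTwo P =
  ∃[ i ] ∃[ j ] (i ≢ j × P i × P j × (∀ l → P l → l ≡ i ⊎ l ≡ j))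

module _ {c ℓ : Level} (G : Group c ℓ) where
  open Group G

  NonAbelian : Set (c ⊔ ℓ)
  NonAbelian = ¬ Commutative _≈_ _∙_

  -- An ordering a₁, …, aₙ of all elements of G, each listed once up to _≈_.
  Arrangement : ℕ → Set (c ⊔ ℓ)
  Arrangement n = Bijection (≡-setoid (Fin n)) setoid

  HasOrder : ℕ → Set (c ⊔ ℓ)
  HasOrder n = Arrangement n

  -- Below the order of G is n = suc k, so that (b₁, …, bₙ₋₁) is indexed by
  -- Fin k. The notions are the intended ones only for n odd: then G has no
  -- involutions, and (n - 1)/2 = ⌊ k /2⌋.
  module _ {k : ℕ} (𝐚 : Arrangement (suc k)) where
    open Bijection 𝐚 using () renaming (to to a)

    b : Fin k → Carrier
    b i = a (inject₁ i) ⁻¹ ∙ a (suc i)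

    OccursUpToInverse : Carrier → Fin k → Set ℓ
    OccursUpToInverse x i = b i ≈ x ⊎ b i ≈ x ⁻¹

    IsTerrace : Set (c ⊔ ℓ)
    IsTerrace = ∀ x → ¬ (x ≈ ε) → ExactlyTwo (OccursUpToInverse x)

    IsDirectedTerrace : Set ℓ
    IsDirectedTerrace = Injective _≡_ _≈_ b

    -- Fin k counts from 0, so the first half of the bᵢ is given by toℕ i < ⌊ k /2⌋.
    IsHalfAndHalf : Set (c ⊔ ℓ)
    IsHalfAndHalf =
      IsTerrace ×
      (∀ g → ¬ (g ≈ ε) → ∃! _≡_ (λ i → toℕ i < ⌊ k /2⌋ × OccursUpToInverse g i))

    IsNarcissistic : Set (c ⊔ ℓ)
    IsNarcissistic = IsTerrace × (∀ i → b i ≈ b (opposite i))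

    IsDirectedHalfAndHalf : Set (c ⊔ ℓ)
    IsDirectedHalfAndHalf = IsDirectedTerrace × IsHalfAndHalf

{-# OPTIONS --safe #-}
module Submission where

-- Terraces are transported along isomorphisms, so it suffices to classify the groups and to
-- exhibit terraces, found by computer search and checked by evaluation, in explicit models.
--
-- Let |G| = 3p with p = 9 or p = 13, G non-abelian. By Lagrange, either every g satisfies
-- g³ = ε or some x has order p. In the latter case ⟨x⟩ is normal: if w = y x y⁻¹ ∉ ⟨x⟩, the 3p
-- products xⁱ wʲ (j < 3) are distinct, so one of them is y⁻¹, and this puts y, hence w, in ⟨x⟩.
-- For y ∉ ⟨x⟩ this gives y x = xʳ y and y³ = xˢ; passing to y² fixes r, and passing to xᵗ y
-- makes s = 0, which determines G. In a group of exponent 3 conjugate elements commute, so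
-- non-commuting x, y have a commutator that commutes with both and generate a Heisenberg group
-- of order 27; by Lagrange this does not fit into a group of order 39.

open import Defs
open import Algebra.Bundles using (Group; RawGroup)
import Algebra.Morphism.GroupMonomorphism as GroupMonomorphism
open import Algebra.Morphism.Structures using (IsGroupMonomorphism; IsGroupIsomorphism)
open import Data.Empty using (⊥-elim)
open import Data.Fin.Base as Fin
  using (Fin; zero; suc; toℕ; fromℕ<; inject; opposite; combine; remQuot)
import Data.Fin.Properties as Fin
open import Data.Nat.Base as ℕ 
  using (ℕ; zero; suc; _+_; _*_; _∸_; _<_; _≤_; z≤n; s≤s; s<s; NonZero; _%_; _/_)
open import Data.Nat.DivMod using (m%n<n; m≡m%n+[m/n]*n; _mod_)
open import Data.Nat.Divisibility using (_∣_; divides; _∣?_; ∣⇒≤)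
open import Data.Nat.GCD using (gcd; gcd-GCD; module Bézout)
import Data.Nat.Properties as ℕ
open import Data.Product using (∃; ∃₂; ∃!; _×_; _,_; proj₁; proj₂; Σ-syntax)
open import Data.Product.Function.NonDependent.Propositional using (_×-↔_)
open import Data.Product.Properties using (≡-dec)
open import Data.Sum as Sum using (_⊎_; inj₁; inj₂; [_,_]′)
open import Data.Vec.Base using (Vec; []; _∷_; lookup; map)
open import Function.Base using (_∘_; id)
open import Function.Bundles using (Bijection; _⤖_; mk⤖)
import Function.Construct.Composition as Composition
open import Function.Definitions using (Injective; Bijective)
open import Function.Properties.Inverse using (↔⇒⤖; ↔-refl; ↔-trans)
open import Level using (Level; 0ℓ)
open import Relation.Binary.Bundles using (Setoid)
open import Relation.Binary.Definitions using (Decidable; DecidableEquality; Tri; tri<; tri≈; tri>)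
open import Relation.Binary.PropositionalEquality as ≡ using (_≡_)
open import Relation.Nullary using (¬_; Dec; yes; no; ¬?; contradiction)
open import Relation.Nullary.Decidable
  using (map′; _×-dec_; _⊎-dec_; _→-dec_; decidable-stable; from-yes; True; toWitness)
open import Tactic.MonoidSolver using (solve)

private variable
  c c′ ℓ ℓ′ ℓ₁ ℓ₂ : Level
  k n : ℕ

-- Transport and decidability of counting statements.

exactlyTwo-map : {P : Fin k → Set ℓ₁} {Q : Fin k → Set ℓ₂} →
  (∀ {i} → P i → Q i) → (∀ {i} → Q i → P i) → ExactlyTwo P → ExactlyTwo Q
exactlyTwo-map f g (i , j , i≢j , pi , pj , only) =
  i , j , i≢j , f pi , f pj , λ l → only l ∘ g

-- The components are reordered so that each candidate index is tested before the next search
-- starts; this keeps evaluation on concrete groups cheap.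
exactlyTwo? : {P : Fin k → Set ℓ₁} → (∀ i → Dec (P i)) → Dec (ExactlyTwo P)
exactlyTwo? P? = map′
  (λ (i , pi , j , i≢j , pj , only) → i , j , i≢j , pi , pj , only)
  (λ (i , j , i≢j , pi , pj , only) → i , pi , j , i≢j , pj , only)
  (Fin.any? λ i → P? i ×-dec Fin.any? λ j → ¬? (i Fin.≟ j) ×-dec P? j ×-dec
    Fin.all? λ l → P? l →-dec ((l Fin.≟ i) ⊎-dec (l Fin.≟ j)))

∃!-map : {P : Fin k → Set ℓ₁} {Q : Fin k → Set ℓ₂} →
  (∀ {i} → P i → Q i) → (∀ {i} → Q i → P i) → ∃! _≡_ P → ∃! _≡_ Q
∃!-map f g (i , pi , unique) = i , f pi , unique ∘ g

∃!? : {P : Fin k → Set ℓ₁} → (∀ i → Dec (P i)) → Dec (∃! _≡_ P)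
∃!? P? = map′
  (λ (i , pi , unique) → i , pi , unique _)
  (λ (i , pi , unique) → i , pi , λ _ → unique)
  (Fin.any? λ i → P? i ×-dec Fin.all? λ j → P? j →-dec (i Fin.≟ j))

module _ (G : Group c ℓ) (𝐚 : Arrangement G (suc k)) where
  open Group G

  occursUpToInverse-resp : ∀ {x y i} → x ≈ y →
    OccursUpToInverse G 𝐚 x i → OccursUpToInverse G 𝐚 y i
  occursUpToInverse-resp x≈y =
    Sum.map (λ e → trans e x≈y) (λ e → trans e (⁻¹-cong x≈y))

-- Search and counting in finite setoids.

module FiniteSetoid (S : Setoid c ℓ) {n : ℕ} (enum : Bijection (≡.setoid (Fin n)) S) where
  open Setoid S
  open Bijection enum using (to; to⁻; surjective)

  to∘to⁻ : ∀ x → to (to⁻ x) ≈ x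
  to∘to⁻ x = proj₂ (surjective x) ≡.refl

  private
    to⁻-cong : ∀ {x y} → x ≈ y → to⁻ x ≡ to⁻ y
    to⁻-cong {x} {y} x≈y =
      Bijection.injective enum (trans (to∘to⁻ x) (trans x≈y (sym (to∘to⁻ y))))

    to⁻-injective : ∀ {x y} → to⁻ x ≡ to⁻ y → x ≈ y
    to⁻-injective {x} {y} e =
      trans (sym (to∘to⁻ x)) (trans (reflexive (≡.cong to e)) (to∘to⁻ y))

  infix 4 _≟_
  _≟_ : Decidable _≈_
  x ≟ y = map′ to⁻-injective to⁻-cong (to⁻ x Fin.≟ to⁻ y)

  abstract
    -- A predicate that respects `_≈_` need only be tested on the enumerated elements, so a finite
    -- search takes the place of excluded middle.
    ∀⊎∃¬ : {P : Carrier → Set ℓ₁} → (∀ {x y} → x ≈ y → P x → P y) →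
           (∀ x → Dec (P x)) → (∀ x → P x) ⊎ (∃ λ x → ¬ P x)
    ∀⊎∃¬ resp P? with Fin.all? (P? ∘ to)
    ... | yes all = inj₁ λ x → resp (to∘to⁻ x) (all (to⁻ x))
    ... | no ¬all with i , ¬pi ← Fin.¬∀⟶∃¬ n _ (P? ∘ to) ¬all = inj₂ (to i , ¬pi)

  injective⇒≤ : ∀ {m} {f : Fin m → Carrier} → Injective _≡_ _≈_ f → m ≤ n
  injective⇒≤ inj = Fin.injective⇒≤ (inj ∘ to⁻-injective)

  surjective⇒≥ : ∀ {m} {f : Fin m → Carrier} → (∀ y → ∃ λ i → f i ≈ y) → n ≤ m
  surjective⇒≥ {f = f} surj = Fin.injective⇒≤ {f = proj₁ ∘ surj ∘ to} λ {i} {j} e →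
    Bijection.injective enum (trans (sym (proj₂ (surj (to i))))
      (trans (reflexive (≡.cong f e)) (proj₂ (surj (to j)))))

  covers? : ∀ {m} (f : Fin m → Carrier) →
            (∀ y → ∃ λ i → f i ≈ y) ⊎ (∃ λ y → ∀ i → ¬ (f i ≈ y))
  covers? f with ∀⊎∃¬ {P = λ y → ∃ λ i → f i ≈ y} (λ x≈y (i , e) → i , trans e x≈y)
                      (λ y → Fin.any? λ i → f i ≟ y)
  ... | inj₁ all        = inj₁ all
  ... | inj₂ (y , ¬hit) = inj₂ (y , λ i e → ¬hit (i , e))

  -- If f missed some y, putting y in front of f would give an injection from `suc n` points into n
  -- elements. The equation `m ≡ n` is an argument so that f may be indexed by a product such as
  -- `p * 3`.
  injective⇒surjective : ∀ {m} → m ≡ n → {f : Fin m → Carrier} → Injective _≡_ _≈_ f →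
                         ∀ y → ∃ λ i → f i ≈ y
  injective⇒surjective ≡.refl {f} inj with covers? f
  ... | inj₁ all          = all
  ... | inj₂ (y , missed) = contradiction (injective⇒≤ extended-injective) ℕ.1+n≰n
    where
    extended : Fin (suc n) → Carrier
    extended zero    = y
    extended (suc i) = f i

    extended-injective : Injective _≡_ _≈_ extended
    extended-injective {zero}  {zero}  e = ≡.refl
    extended-injective {zero}  {suc j} e = ⊥-elim (missed j (sym e))
    extended-injective {suc i} {zero}  e = ⊥-elim (missed i e)
    extended-injective {suc i} {suc j} e = ≡.cong suc (inj e)

-- Deciding the terrace properties.

module DecidableTerraces (G : Group c ℓ) (_≟_ : Decidable (Group._≈_ G))
                         (𝐚 : Arrangement G (suc k)) where
  open Group G
  open Bijection 𝐚 using (to; to⁻)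
  open FiniteSetoid setoid 𝐚 using (to∘to⁻)

  private
    occurs? : ∀ x i → Dec (OccursUpToInverse G 𝐚 x i)
    occurs? x i = (b G 𝐚 i ≟ x) ⊎-dec (b G 𝐚 i ≟ (x ⁻¹))

    ∀≉ε? : {P : Carrier → Set ℓ₁} → (∀ {x y} → x ≈ y → P x → P y) →
           (∀ x → Dec (P x)) → Dec (∀ x → ¬ (x ≈ ε) → P x)
    ∀≉ε? resp P? = map′
      (λ h x x≉ε → resp (to∘to⁻ x) (h (to⁻ x) (x≉ε ∘ trans (sym (to∘to⁻ x)))))
      (λ h i → h (to i))
      (Fin.all? λ i → ¬? (to i ≟ ε) →-dec P? (to i))

  isTerrace? : Dec (IsTerrace G 𝐚)
  isTerrace? = ∀≉ε?
    (λ x≈y → exactlyTwo-map (occursUpToInverse-resp G 𝐚 x≈y) (occursUpToInverse-resp G 𝐚 (sym x≈y)))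
    (λ x → exactlyTwo? (occurs? x))

  isDirectedTerrace? : Dec (IsDirectedTerrace G 𝐚)
  isDirectedTerrace? = map′ (λ h {i} {j} → h i j) (λ h i j → h)
    (Fin.all? λ i → Fin.all? λ j → (b G 𝐚 i ≟ b G 𝐚 j) →-dec (i Fin.≟ j))

  isHalfAndHalf? : Dec (IsHalfAndHalf G 𝐚)
  isHalfAndHalf? = isTerrace? ×-dec ∀≉ε?
    (λ x≈y → ∃!-map
      (λ (i< , o) → i< , occursUpToInverse-resp G 𝐚 x≈y o)
      (λ (i< , o) → i< , occursUpToInverse-resp G 𝐚 (sym x≈y) o))
    (λ x → ∃!? λ i → (toℕ i ℕ.<? _) ×-dec occurs? x i)

  isNarcissistic? : Dec (IsNarcissistic G 𝐚)
  isNarcissistic? =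
    isTerrace? ×-dec Fin.all? λ i → b G 𝐚 i ≟ b G 𝐚 (opposite i)

  isDirectedHalfAndHalf? : Dec (IsDirectedHalfAndHalf G 𝐚)
  isDirectedHalfAndHalf? = isDirectedTerrace? ×-dec isHalfAndHalf?

-- Transport of terraces along isomorphisms.

module IsomorphicTerraces
  (K : Group c ℓ) (G : Group c′ ℓ′) {φ : Group.Carrier K → Group.Carrier G}
  (φ-iso : IsGroupIsomorphism (Group.rawGroup K) (Group.rawGroup G) φ)
  where
  private
    module K = Group K
    open Group G
    module φ = IsGroupIsomorphism φ-iso

  image : Arrangement K n → Arrangement G n
  image 𝐚 = Composition.bijection 𝐚 record
    { to = φ ; cong = φ.⟦⟧-cong ; bijective = φ.injective , φ.surjective }

  module _ (𝐚 : Arrangement K (suc k)) where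
    private
      b-image : ∀ i → b G (image 𝐚) i ≈ φ (b K 𝐚 i)
      b-image i = sym (trans (φ.∙-homo _ _) (∙-congʳ (φ.⁻¹-homo _)))

      fromImage : ∀ {x i} → OccursUpToInverse G (image 𝐚) (φ x) i → OccursUpToInverse K 𝐚 x i
      fromImage {x} {i} = Sum.map
        (λ e → φ.injective (trans (sym (b-image i)) e))
        (λ e → φ.injective (trans (sym (b-image i)) (trans e (sym (φ.⁻¹-homo x)))))

      toImage : ∀ {x i} → OccursUpToInverse K 𝐚 x i → OccursUpToInverse G (image 𝐚) (φ x) i
      toImage {x} {i} = Sum.map
        (λ e → trans (b-image i) (φ.⟦⟧-cong e))
        (λ e → trans (b-image i) (trans (φ.⟦⟧-cong e) (φ.⁻¹-homo x)))

      preimage : ∀ y → ∃ λ x → φ x ≈ y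
      preimage y = let x , φx≈y = φ.surjective y in x , φx≈y K.refl

      ≉ε-preimage : ∀ {x y} → φ x ≈ y → ¬ (y ≈ ε) → ¬ (x K.≈ K.ε)
      ≉ε-preimage φx≈y y≉ε x≈ε = y≉ε (trans (sym φx≈y) (trans (φ.⟦⟧-cong x≈ε) φ.ε-homo))

    -- Since φ is onto, the condition at y can be read off at a preimage of y; since φ is injective,
    -- it reflects the equations satisfied by the quotients `b`.
    isTerrace-image : IsTerrace K 𝐚 → IsTerrace G (image 𝐚)
    isTerrace-image terrace y y≉ε = let x , φx≈y = preimage y in
      exactlyTwo-map
        (occursUpToInverse-resp G (image 𝐚) φx≈y ∘ toImage)
        (fromImage ∘ occursUpToInverse-resp G (image 𝐚) (sym φx≈y))
        (terrace x (≉ε-preimage φx≈y y≉ε))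

    isNarcissistic-image : IsNarcissistic K 𝐚 → IsNarcissistic G (image 𝐚)
    isNarcissistic-image (terrace , palindrome) = isTerrace-image terrace ,
      λ i → trans (b-image i) (trans (φ.⟦⟧-cong (palindrome i)) (sym (b-image (opposite i))))

    isDirectedHalfAndHalf-image : IsDirectedHalfAndHalf K 𝐚 → IsDirectedHalfAndHalf G (image 𝐚)
    isDirectedHalfAndHalf-image (directed , terrace , half) =
      (λ {i} {j} e → directed (φ.injective (trans (sym (b-image i)) (trans e (b-image j))))) ,
      isTerrace-image terrace ,
      λ y y≉ε → let x , φx≈y = preimage y in
        ∃!-map
          (λ (i< , o) → i< , occursUpToInverse-resp G (image 𝐚) φx≈y (toImage o))
          (λ (i< , o) → i< , fromImage (occursUpToInverse-resp G (image 𝐚) (sym φx≈y) o))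
          (half x (≉ε-preimage φx≈y y≉ε))

remQuot-injective : ∀ {m} n → Injective _≡_ _≡_ (remQuot {m} n)
remQuot-injective {m} n {i} {j} e = ≡.trans (≡.sym (Fin.combine-remQuot {m} n i))
  (≡.trans (≡.cong (λ (q , r) → combine q r) e) (Fin.combine-remQuot {m} n j))

-- Powers, normal forms and orders of elements.

module Powers (G : Group c ℓ) where
  open Group G
  open import Algebra.Properties.Group G using (∙-cancelʳ)
  open import Algebra.Properties.Semigroup semigroup using (uv≈wx⇒yu∙vz≈yw∙xz)
  open import Algebra.Properties.Monoid.Mult monoid
    using (×-congʳ; ×-homo-+; ×-assocˡ) renaming (_×_ to _times_)
  open import Relation.Binary.Reasoning.Setoid setoid

  infixr 8 _^_

  -- Kept abstract so that x ^ m never unfolds along a computed exponent m.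
  abstract
    _^_ : Carrier → ℕ → Carrier
    x ^ n = n times x

    ^-zero : ∀ x → x ^ 0 ≈ ε
    ^-zero x = refl

    ^-suc : ∀ x n → x ^ suc n ≈ x ∙ x ^ n
    ^-suc x n = refl

    ^-congˡ : ∀ {x y} n → x ≈ y → x ^ n ≈ y ^ n
    ^-congˡ n = ×-congʳ n

    ^-homo-+ : ∀ x m n → x ^ (m + n) ≈ x ^ m ∙ x ^ n
    ^-homo-+ = ×-homo-+

    ^-assoc : ∀ x m n → (x ^ m) ^ n ≈ x ^ (n * m)
    ^-assoc x m n = ×-assocˡ x n m

    ^-one : ∀ x → x ^ 1 ≈ x
    ^-one = identityʳ

    ε-^ : ∀ n → ε ^ n ≈ ε
    ε-^ zero    = refl
    ε-^ (suc n) = trans (identityˡ _) (ε-^ n)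

  ^-congʳ : ∀ x {m n} → m ≡ n → x ^ m ≈ x ^ n
  ^-congʳ x e = reflexive (≡.cong (x ^_) e)

  ^-three : ∀ x → x ^ 3 ≈ x ∙ x ∙ x
  ^-three x = begin
    x ^ 3                  ≈⟨ ^-homo-+ x 2 1 ⟩
    x ^ 2 ∙ x ^ 1          ≈⟨ ∙-congʳ (^-homo-+ x 1 1) ⟩
    x ^ 1 ∙ x ^ 1 ∙ x ^ 1  ≈⟨ ∙-cong (∙-cong (^-one x) (^-one x)) (^-one x) ⟩
    x ∙ x ∙ x              ∎

  ^-multiple : ∀ {x d} → x ^ d ≈ ε → ∀ q → x ^ (q * d) ≈ ε
  ^-multiple {x} {d} xᵈ≈ε q =
    trans (sym (^-assoc x d q)) (trans (^-congˡ q xᵈ≈ε) (ε-^ q))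

  ^-∣ : ∀ {x d m} → x ^ d ≈ ε → d ∣ m → x ^ m ≈ ε
  ^-∣ {x} xᵈ≈ε (divides q m≡q*d) = trans (^-congʳ x m≡q*d) (^-multiple xᵈ≈ε q)

  ^-+-multiple : ∀ {x d} → x ^ d ≈ ε → ∀ m q → x ^ (m + q * d) ≈ x ^ m
  ^-+-multiple {x} {d} xᵈ≈ε m q = trans (^-homo-+ x m (q * d))
    (trans (∙-congˡ (^-multiple xᵈ≈ε q)) (identityʳ _))

  ^-% : ∀ {x d} .{{_ : NonZero d}} → x ^ d ≈ ε → ∀ m → x ^ (m % d) ≈ x ^ m
  ^-% {x} {d} xᵈ≈ε m = sym (trans (^-congʳ x (m≡m%n+[m/n]*n m d))
    (^-+-multiple xᵈ≈ε (m % d) (m / d)))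

  ^-mod : ∀ {x d} .{{_ : NonZero d}} → x ^ d ≈ ε → ∀ m → x ^ toℕ (m mod d) ≈ x ^ m
  ^-mod {x} {d} xᵈ≈ε m =
    trans (^-congʳ x (Fin.toℕ-fromℕ< (m%n<n m d))) (^-% xᵈ≈ε m)

  ^-complement : ∀ {x d} → x ^ d ≈ ε → ∀ {i} → i ≤ d → x ^ (d ∸ i) ∙ x ^ i ≈ ε
  ^-complement {x} {d} xᵈ≈ε {i} i≤d = trans (sym (^-homo-+ x (d ∸ i) i))
    (trans (^-congʳ x (ℕ.m∸n+n≡m i≤d)) xᵈ≈ε)

  ^-cong-% : ∀ {x d} .{{_ : NonZero d}} → x ^ d ≈ ε → ∀ {m n} → m % d ≡ n % d → x ^ m ≈ x ^ n
  ^-cong-% {x} xᵈ≈ε {m} {n} e =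
    trans (sym (^-% xᵈ≈ε m)) (trans (^-congʳ x e) (^-% xᵈ≈ε n))

  -- This is the rule (y x y⁻¹)ᵐ = y xᵐ y⁻¹ with the inverses cleared.
  intertwine-^ : ∀ {x y w} → y ∙ x ≈ w ∙ y → ∀ m → y ∙ x ^ m ≈ w ^ m ∙ y
  intertwine-^ {x} {y} {w} yx≈wy zero    = begin
    y ∙ x ^ 0        ≈⟨ ∙-congˡ (^-zero x) ⟩
    y ∙ ε            ≈⟨ identityʳ y ⟩
    y                ≈⟨ identityˡ y ⟨
    ε ∙ y            ≈⟨ ∙-congʳ (^-zero w) ⟨
    w ^ 0 ∙ y        ∎
  intertwine-^ {x} {y} {w} yx≈wy (suc m) = begin
    y ∙ x ^ suc m    ≈⟨ ∙-congˡ (^-suc x m) ⟩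
    y ∙ (x ∙ x ^ m)  ≈⟨ assoc y x (x ^ m) ⟨
    y ∙ x ∙ x ^ m    ≈⟨ ∙-congʳ yx≈wy ⟩
    w ∙ y ∙ x ^ m    ≈⟨ assoc w y (x ^ m) ⟩
    w ∙ (y ∙ x ^ m)  ≈⟨ ∙-congˡ (intertwine-^ yx≈wy m) ⟩
    w ∙ (w ^ m ∙ y)  ≈⟨ assoc w (w ^ m) y ⟨
    w ∙ w ^ m ∙ y    ≈⟨ ∙-congʳ (^-suc w m) ⟨
    w ^ suc m ∙ y    ∎

  commute-^ : ∀ {x y} → y ∙ x ≈ x ∙ y → ∀ m n → y ^ m ∙ x ^ n ≈ x ^ n ∙ y ^ m
  commute-^ yx≈xy m n = sym (intertwine-^ (sym (intertwine-^ yx≈xy n)) m)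

  ∙-^ : ∀ {x y} → y ∙ x ≈ x ∙ y → ∀ m → (x ∙ y) ^ m ≈ x ^ m ∙ y ^ m
  ∙-^ {x} {y} yx≈xy zero = trans (^-zero _) (sym (trans (∙-cong (^-zero x) (^-zero y)) (identityʳ ε)))
  ∙-^ {x} {y} yx≈xy (suc m) = begin
    (x ∙ y) ^ suc m            ≈⟨ ^-suc _ m ⟩
    (x ∙ y) ∙ (x ∙ y) ^ m      ≈⟨ ∙-congˡ (∙-^ yx≈xy m) ⟩
    (x ∙ y) ∙ (x ^ m ∙ y ^ m)  ≈⟨ uv≈wx⇒yu∙vz≈yw∙xz (intertwine-^ yx≈xy m) x (y ^ m) ⟩
    (x ∙ x ^ m) ∙ (y ∙ y ^ m)  ≈⟨ ∙-cong (^-suc x m) (^-suc y m) ⟨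
    x ^ suc m ∙ y ^ suc m      ∎

  -- Each of the j factors y that moves past a power of x multiplies its exponent by r.
  intertwine-^-^ : ∀ {x y r} → y ∙ x ≈ x ^ r ∙ y →
                   ∀ j b → y ^ j ∙ x ^ b ≈ x ^ (r ℕ.^ j * b) ∙ y ^ j
  intertwine-^-^ {x} {y} {r} yx≈xʳy zero b = begin
    y ^ 0 ∙ x ^ b        ≈⟨ ∙-congʳ (^-zero y) ⟩
    ε ∙ x ^ b            ≈⟨ identityˡ _ ⟩
    x ^ b                ≈⟨ ^-congʳ x (ℕ.*-identityˡ b) ⟨
    x ^ (1 * b)          ≈⟨ identityʳ _ ⟨
    x ^ (1 * b) ∙ ε      ≈⟨ ∙-congˡ (^-zero y) ⟨
    x ^ (1 * b) ∙ y ^ 0  ∎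
  intertwine-^-^ {x} {y} {r} yx≈xʳy (suc j) b = begin
    y ^ suc j ∙ x ^ b                      ≈⟨ ∙-congʳ (^-suc y j) ⟩
    y ∙ y ^ j ∙ x ^ b                      ≈⟨ assoc _ _ _ ⟩
    y ∙ (y ^ j ∙ x ^ b)                    ≈⟨ ∙-congˡ (intertwine-^-^ yx≈xʳy j b) ⟩
    y ∙ (x ^ (r ℕ.^ j * b) ∙ y ^ j)        ≈⟨ assoc _ _ _ ⟨
    y ∙ x ^ (r ℕ.^ j * b) ∙ y ^ j          ≈⟨ ∙-congʳ (intertwine-^ yx≈xʳy _) ⟩
    (x ^ r) ^ (r ℕ.^ j * b) ∙ y ∙ y ^ j    ≈⟨ assoc _ _ _ ⟩
    (x ^ r) ^ (r ℕ.^ j * b) ∙ (y ∙ y ^ j)  ≈⟨ ∙-cong (^-assoc x r _) (sym (^-suc y j)) ⟩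
    x ^ (r ℕ.^ j * b * r) ∙ y ^ suc j      ≈⟨ ∙-congʳ (^-congʳ x exponent) ⟩
    x ^ (r ℕ.^ suc j * b) ∙ y ^ suc j      ∎
    where
    exponent : r ℕ.^ j * b * r ≡ r ℕ.^ suc j * b
    exponent = ≡.trans (ℕ.*-comm (r ℕ.^ j * b) r) (≡.sym (ℕ.*-assoc r (r ℕ.^ j) b))

  -- This is the multiplication rule of `metacyclic`, before exponents are reduced; it holds in any
  -- group with the relation y x = xʳ y.
  normalForm-∙ : ∀ {x y r} → y ∙ x ≈ x ^ r ∙ y → ∀ a j b l →
    (x ^ a ∙ y ^ j) ∙ (x ^ b ∙ y ^ l) ≈ x ^ (a + r ℕ.^ j * b) ∙ y ^ (j + l)
  normalForm-∙ {x} {y} {r} yx≈xʳy a j b l = begin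
    (x ^ a ∙ y ^ j) ∙ (x ^ b ∙ y ^ l)              ≈⟨ uv≈wx⇒yu∙vz≈yw∙xz (intertwine-^-^ yx≈xʳy j b) _ _ ⟩
    (x ^ a ∙ x ^ (r ℕ.^ j * b)) ∙ (y ^ j ∙ y ^ l)  ≈⟨ ∙-cong (^-homo-+ x a _) (^-homo-+ y j l) ⟨
    x ^ (a + r ℕ.^ j * b) ∙ y ^ (j + l)            ∎

  -- For d = 0 both fields hold for every x, so this is the order of x only together with
  -- `NonZero d` or with a condition that excludes 0.
  record Order (x : Carrier) (d : ℕ) : Set ℓ where
    field
      ^-order     : x ^ d ≈ ε
      ^-injective : ∀ {i j} → i < d → j < d → x ^ i ≈ x ^ j → i ≡ j

    ^-injective-% : .{{_ : NonZero d}} → ∀ {m n} → x ^ m ≈ x ^ n → m % d ≡ n % d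
    ^-injective-% {m} {n} e = ^-injective (m%n<n m d) (m%n<n n d)
      (trans (^-% ^-order m) (trans e (sym (^-% ^-order n))))

  -- The extra factor w allows powers to be compared modulo a subgroup, as in `products-injective`;
  -- plain powers are the case w = ε.
  ^-difference : ∀ x {i j} w → i ≤ j → x ^ i ≈ w ∙ x ^ j → ε ≈ w ∙ x ^ (j ∸ i)
  ^-difference x {i} {j} w i≤j e = ∙-cancelʳ (x ^ i) _ _ (begin
    ε ∙ x ^ i                  ≈⟨ identityˡ _ ⟩
    x ^ i                      ≈⟨ e ⟩
    w ∙ x ^ j                  ≈⟨ ∙-congˡ (^-congʳ x (≡.sym (ℕ.m∸n+n≡m i≤j))) ⟩
    w ∙ x ^ (j ∸ i + i)        ≈⟨ ∙-congˡ (^-homo-+ x (j ∸ i) i) ⟩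
    w ∙ (x ^ (j ∸ i) ∙ x ^ i)  ≈⟨ assoc w _ _ ⟨
    w ∙ x ^ (j ∸ i) ∙ x ^ i    ∎)

  powers-distinct : ∀ {x d} → (∀ i → 0 < i → i < d → ¬ (x ^ i ≈ ε)) →
                    ∀ {i j} → i < d → j < d → x ^ i ≈ x ^ j → i ≡ j
  powers-distinct {x} {d} nontrivial {i} {j} i<d j<d e = by-cases (ℕ.<-cmp i j)
    where
    absurd : ∀ {i j} → i < j → j < d → ¬ (x ^ i ≈ x ^ j)
    absurd {i} {j} i<j j<d e = nontrivial (j ∸ i)
      (ℕ.m<n⇒0<n∸m i<j) (ℕ.≤-<-trans (ℕ.m∸n≤m j i) j<d)
      (sym (trans (^-difference x ε (ℕ.<⇒≤ i<j) (trans e (sym (identityˡ _)))) (identityˡ _)))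

    by-cases : Tri (i < j) (i ≡ j) (j < i) → i ≡ j
    by-cases (tri< i<j _ _) = ⊥-elim (absurd i<j j<d e)
    by-cases (tri≈ _ i≡j _) = i≡j
    by-cases (tri> _ _ j<i) = ⊥-elim (absurd j<i i<d (sym e))

-- Finite groups: Lagrange's theorem, orders and cyclic subgroups.

module FiniteGroup (G : Group c ℓ) {k : ℕ} (enum : HasOrder G (suc k)) where
  open Group G
  open import Algebra.Properties.Group G using (∙-cancelˡ; ∙-cancelʳ; inverseˡ-unique)
  open Powers G public
  open FiniteSetoid setoid enum public
  open import Relation.Binary.Reasoning.Setoid setoid

  private
    ∣G∣ : ℕ
    ∣G∣ = suc k

  -- The subgroup is given by a repetition-free listing f whose image is closed under a b⁻¹. A
  -- family t holds representatives of distinct left cosets, and `grid t` lists the union of these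
  -- cosets.
  module Lagrange {m : ℕ} .{{_ : NonZero m}} {f : Fin m → Carrier}
    (f-injective : Injective _≡_ _≈_ f)
    (f-closed : ∀ i j → ∃ λ l → f i ∙ f j ⁻¹ ≈ f l) where

    private
      grid : ∀ {q} → (Fin q → Carrier) → Fin q × Fin m → Carrier
      grid t (i , j) = t i ∙ f j

      extend : ∀ {q} → Carrier → (Fin q → Carrier) → Fin (suc q) → Carrier
      extend g t zero    = g
      extend g t (suc i) = t i

      -- If g h = tᵢ h′ with h and h′ in the subgroup, then g = tᵢ (h′ h⁻¹) is already in the grid.
      extend-injective : ∀ {q} {t : Fin q → Carrier} {g} → Injective _≡_ _≈_ (grid t) →
        (∀ u → ¬ (grid t u ≈ g)) → Injective _≡_ _≈_ (grid (extend g t))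
      extend-injective {q} {t} {g} inj missed = inj′
        where
        disjoint : ∀ j i l → ¬ (g ∙ f j ≈ t i ∙ f l)
        disjoint j i l e with h , e′ ← f-closed l j = missed (i , h) (sym (begin
          g                     ≈⟨ identityʳ g ⟨
          g ∙ ε                 ≈⟨ ∙-congˡ (inverseʳ (f j)) ⟨
          g ∙ (f j ∙ f j ⁻¹)    ≈⟨ assoc _ _ _ ⟨
          g ∙ f j ∙ f j ⁻¹      ≈⟨ ∙-congʳ e ⟩
          t i ∙ f l ∙ f j ⁻¹    ≈⟨ assoc _ _ _ ⟩
          t i ∙ (f l ∙ f j ⁻¹)  ≈⟨ ∙-congˡ e′ ⟩
          t i ∙ f h             ∎))

        inj′ : Injective _≡_ _≈_ (grid (extend g t))
        inj′ {zero  , j} {zero  , l} e = ≡.cong (zero ,_) (f-injective (∙-cancelˡ g _ _ e))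
        inj′ {zero  , j} {suc i , l} e = ⊥-elim (disjoint j i l e)
        inj′ {suc i , j} {zero  , l} e = ⊥-elim (disjoint l i j (sym e))
        inj′ {suc i , j} {suc h , l} e = ≡.cong (λ (a , b) → suc a , b) (inj {i , j} {h , l} e)

      -- Cosets are added greedily until the grid covers G, and then `q * m` is the order of G.
      -- Injectivity gives q ≤ `q * m` ≤ `∣G∣` throughout, so the bound on `fuel + q` is
      -- contradicted if the fuel runs out first.
      divides-from : ∀ fuel {q} {t : Fin q → Carrier} → Injective _≡_ _≈_ (grid t) →
                     ∣G∣ < fuel + q → m ∣ ∣G∣
      divides-from fuel {q} {t} inj n<
        with q*m≤n ← injective⇒≤ (remQuot-injective {q} m ∘ inj) | fuel
      ... | zero = contradiction (ℕ.≤-trans (ℕ.m≤m*n q m) q*m≤n) (ℕ.<⇒≱ n<)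
      ... | suc fuel with covers? (grid t ∘ remQuot {q} m)
      ...   | inj₁ all = divides q (ℕ.≤-antisym (surjective⇒≥ all) q*m≤n)
      ...   | inj₂ (g , missed) = divides-from fuel
              (extend-injective inj λ (i , j) e → missed (combine i j)
                (trans (reflexive (≡.cong (grid t) (Fin.remQuot-combine i j))) e))
              (≡.subst (∣G∣ <_) (≡.sym (ℕ.+-suc fuel q)) n<)

    order-divides : m ∣ ∣G∣
    order-divides = divides-from (suc ∣G∣) {0} {λ ()} (λ {})
      (ℕ.≤-reflexive (≡.sym (ℕ.+-identityʳ (suc ∣G∣))))

  abstract
    -- The powers of x with exponents 0 to `∣G∣` cannot all be distinct, so some positive exponent
    -- up to `∣G∣` gives ε; the least one is the order.
    someOrder : ∀ x → ∃ λ d → NonZero d × Order x d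
    someOrder x = suc (toℕ i) , _ , record
        { ^-order     = decidable-stable (_ ≟ _) ¬¬xᵈ≈ε
        ; ^-injective = powers-distinct least
        }
      where
      -- Index i stands for the exponent i + 1. P is a negation because the search below returns the
      -- smallest index at which its predicate fails.
      P : Fin ∣G∣ → Set ℓ
      P i = ¬ (x ^ suc (toℕ i) ≈ ε)

      ¬all : ¬ (∀ i → P i)
      ¬all all = contradiction
        (injective⇒≤ {f = λ i → x ^ toℕ i} λ {i} {j} e → Fin.toℕ-injective
          (powers-distinct {d = suc ∣G∣} nontrivial (Fin.toℕ<n i) (Fin.toℕ<n j) e))
        ℕ.1+n≰n
        where
        nontrivial : ∀ i → 0 < i → i < suc ∣G∣ → ¬ (x ^ i ≈ ε)
        nontrivial (suc i) _ (s<s i<n) =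
          ≡.subst (λ i → ¬ (x ^ suc i ≈ ε)) (Fin.toℕ-fromℕ< i<n) (all (fromℕ< i<n))

      smallest : ∃ λ i → ¬ P i × ((j : Fin.Fin′ i) → P (inject j))
      smallest = Fin.¬∀⟶∃¬-smallest ∣G∣ P (λ i → ¬? (_ ≟ _)) ¬all

      i : Fin ∣G∣
      i = proj₁ smallest

      ¬¬xᵈ≈ε : ¬ P i
      ¬¬xᵈ≈ε = proj₁ (proj₂ smallest)

      least : ∀ j → 0 < j → j < suc (toℕ i) → ¬ (x ^ j ≈ ε)
      least (suc j) _ (s<s j<i) = ≡.subst (λ j → ¬ (x ^ suc j ≈ ε))
        (≡.trans (Fin.toℕ-inject (fromℕ< j<i)) (Fin.toℕ-fromℕ< j<i))
        (proj₂ (proj₂ smallest) (fromℕ< j<i))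

  order-∣ : ∀ {x d} .{{_ : NonZero d}} → Order x d → d ∣ ∣G∣
  order-∣ {x} {d} o = Lagrange.order-divides {f = λ (i : Fin d) → x ^ toℕ i}
    (λ {i} {j} e → Fin.toℕ-injective (^-injective (Fin.toℕ<n i) (Fin.toℕ<n j) e))
    (λ i j → (toℕ i + (d ∸ toℕ j)) mod d , (begin
      x ^ toℕ i ∙ (x ^ toℕ j) ⁻¹             ≈⟨ ∙-congˡ (inverseˡ-unique _ _ (x^[d∸j]∙x^j≈ε j)) ⟨
      x ^ toℕ i ∙ x ^ (d ∸ toℕ j)            ≈⟨ ^-homo-+ x (toℕ i) _ ⟨
      x ^ (toℕ i + (d ∸ toℕ j))              ≈⟨ ^-mod ^-order _ ⟨
      x ^ toℕ ((toℕ i + (d ∸ toℕ j)) mod d)  ∎))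
    where
    open Order o

    x^[d∸j]∙x^j≈ε : ∀ (j : Fin d) → x ^ (d ∸ toℕ j) ∙ x ^ toℕ j ≈ ε
    x^[d∸j]∙x^j≈ε j = ^-complement ^-order (ℕ.<⇒≤ (Fin.toℕ<n j))

  order : ∀ x → ∃ λ d → d ∣ ∣G∣ × Order x d
  order x = let d , d≢0 , o = someOrder x in d , order-∣ {{d≢0}} o , o

  ^-cardinality : ∀ x → x ^ ∣G∣ ≈ ε
  ^-cardinality x = let d , d∣n , o = order x in ^-∣ (Order.^-order o) d∣n

  ⁻¹≈^ : ∀ x → x ⁻¹ ≈ x ^ k
  ⁻¹≈^ x = sym (inverseˡ-unique (x ^ k) x (trans (∙-congˡ (sym (^-one x)))
    (trans (sym (^-homo-+ x k 1)) (trans (^-congʳ x (ℕ.+-comm k 1)) (^-cardinality x)))))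

  infix 4 _∈⟨_⟩
  -- Natural exponents describe the whole cyclic subgroup, because by `⁻¹≈^` an inverse is itself a
  -- power.
  _∈⟨_⟩ : Carrier → Carrier → Set ℓ
  y ∈⟨ x ⟩ = ∃ λ i → y ≈ x ^ i

  module Cyclic {x : Carrier} where
    ∈-resp : ∀ {y z} → y ≈ z → y ∈⟨ x ⟩ → z ∈⟨ x ⟩
    ∈-resp y≈z (i , e) = i , trans (sym y≈z) e

    ∈-∙ : ∀ {y z} → y ∈⟨ x ⟩ → z ∈⟨ x ⟩ → y ∙ z ∈⟨ x ⟩
    ∈-∙ (i , e) (j , f) = i + j , trans (∙-cong e f) (sym (^-homo-+ x i j))

    ∈-^ : ∀ {y} m → y ∈⟨ x ⟩ → y ^ m ∈⟨ x ⟩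
    ∈-^ m (i , e) = m * i , trans (^-congˡ m e) (^-assoc x i m)

    ∈-⁻¹ : ∀ {y} → y ∈⟨ x ⟩ → y ⁻¹ ∈⟨ x ⟩
    ∈-⁻¹ {y} y∈ = ∈-resp (sym (⁻¹≈^ y)) (∈-^ k y∈)

    ∈-cancelˡ : ∀ {y z} → y ∈⟨ x ⟩ → y ∙ z ∈⟨ x ⟩ → z ∈⟨ x ⟩
    ∈-cancelˡ {y} {z} y∈ yz∈ = ∈-resp
      (trans (sym (assoc _ _ _)) (trans (∙-congʳ (inverseˡ y)) (identityˡ z))) (∈-∙ (∈-⁻¹ y∈) yz∈)

    ∈-cancelʳ : ∀ {y z} → z ∈⟨ x ⟩ → y ∙ z ∈⟨ x ⟩ → y ∈⟨ x ⟩
    ∈-cancelʳ {y} {z} z∈ yz∈ = ∈-resp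
      (trans (assoc _ _ _) (trans (∙-congˡ (inverseʳ z)) (identityʳ y))) (∈-∙ yz∈ (∈-⁻¹ z∈))

    -- Bézout's identity is used in the subtraction-free form d + t v = s u: the element y ^ (s u)
    -- is y ^ d times a member of ⟨x⟩, and that member cancels.
    ∈-gcd : ∀ {y} a b → y ^ a ∈⟨ x ⟩ → y ^ b ∈⟨ x ⟩ → y ^ gcd a b ∈⟨ x ⟩
    ∈-gcd {y} a b yᵃ∈ yᵇ∈ = case (Bézout.identity (gcd-GCD a b))
      where
      combination : ∀ d u v s t → y ^ u ∈⟨ x ⟩ → y ^ v ∈⟨ x ⟩ → d + t * v ≡ s * u → y ^ d ∈⟨ x ⟩
      combination d u v s t yᵘ∈ yᵛ∈ e = ∈-cancelʳ
        (∈-resp (^-assoc y v t) (∈-^ t yᵛ∈))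
        (∈-resp (trans (^-assoc y u s) (trans (^-congʳ y (≡.sym e)) (^-homo-+ y d (t * v))))
          (∈-^ s yᵘ∈))

      case : Bézout.Identity (gcd a b) a b → y ^ gcd a b ∈⟨ x ⟩
      case (Bézout.+- s t e) = combination _ a b s t yᵃ∈ yᵇ∈ e
      case (Bézout.-+ s t e) = combination _ b a t s yᵇ∈ yᵃ∈ e

  open Cyclic public

  _∈?⟨_⟩ : ∀ y x → Dec (y ∈⟨ x ⟩)
  y ∈?⟨ x ⟩ = map′
    (λ (i , e) → toℕ i , e)
    (λ (i , e) → i mod ∣G∣ , trans e (sym (^-mod (^-cardinality x) i)))
    (Fin.any? {n = ∣G∣} λ i → y ≟ x ^ toℕ i)

  -- An equation xᵃ wʲ = xᵇ wʲ′ with j < j′ would put w ^ (j′ ∸ j) in ⟨x⟩.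
  products-injective : ∀ {x w d q} → Order x d → (∀ j → 0 < j → j < q → ¬ (w ^ j ∈⟨ x ⟩)) →
    Injective _≡_ _≈_ (λ ((i , j) : Fin d × Fin q) → x ^ toℕ i ∙ w ^ toℕ j)
  products-injective {x} {w} {d} {q} o outside {i , j} {i′ , j′} e =
    by-cases (ℕ.<-cmp (toℕ j) (toℕ j′))
    where
    absurd : ∀ a b {j j′} → j < j′ → j′ < q → ¬ (x ^ a ∙ w ^ j ≈ x ^ b ∙ w ^ j′)
    absurd a b {j} {j′} j<j′ j′<q e =
      outside (j′ ∸ j) (ℕ.m<n⇒0<n∸m j<j′) (ℕ.≤-<-trans (ℕ.m∸n≤m j′ j) j′<q)
        (∈-cancelˡ (∈-∙ (∈-⁻¹ (a , refl)) (b , refl))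
          (0 , trans (sym (^-difference w _ (ℕ.<⇒≤ j<j′) wʲ)) (sym (^-zero x))))
      where
      wʲ : w ^ j ≈ (x ^ a) ⁻¹ ∙ x ^ b ∙ w ^ j′
      wʲ = begin
        w ^ j                          ≈⟨ identityˡ _ ⟨
        ε ∙ w ^ j                      ≈⟨ ∙-congʳ (inverseˡ _) ⟨
        (x ^ a) ⁻¹ ∙ x ^ a ∙ w ^ j     ≈⟨ assoc _ _ _ ⟩
        (x ^ a) ⁻¹ ∙ (x ^ a ∙ w ^ j)   ≈⟨ ∙-congˡ e ⟩
        (x ^ a) ⁻¹ ∙ (x ^ b ∙ w ^ j′)  ≈⟨ assoc _ _ _ ⟨
        (x ^ a) ⁻¹ ∙ x ^ b ∙ w ^ j′    ∎

    by-cases : Tri (toℕ j < toℕ j′) (toℕ j ≡ toℕ j′) (toℕ j′ < toℕ j) → (i , j) ≡ (i′ , j′)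
    by-cases (tri< j<j′ _ _) = ⊥-elim (absurd (toℕ i) (toℕ i′) j<j′ (Fin.toℕ<n j′) e)
    by-cases (tri> _ _ j′<j) = ⊥-elim (absurd (toℕ i′) (toℕ i) j′<j (Fin.toℕ<n j) (sym e))
    by-cases (tri≈ _ j≡j′ _) with ≡.refl ← Fin.toℕ-injective j≡j′ = ≡.cong (_, j)
      (Fin.toℕ-injective (Order.^-injective o (Fin.toℕ<n i) (Fin.toℕ<n i′) (∙-cancelʳ _ _ _ e)))

  ∈⟨⟩-commute : ∀ {x y z} → y ∈⟨ x ⟩ → z ∈⟨ x ⟩ → y ∙ z ≈ z ∙ y
  ∈⟨⟩-commute {x} (i , e) (j , f) =
    trans (∙-cong e f) (trans (commute-^ {x} {x} refl i j) (sym (∙-cong f e)))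

  full-order⇒generator : ∀ {x} → Order x ∣G∣ → ∀ y → y ∈⟨ x ⟩
  full-order⇒generator {x} o y =
    let i , e = injective⇒surjective ≡.refl {λ i → x ^ toℕ i}
          (λ {i} {j} e → Fin.toℕ-injective (Order.^-injective o (Fin.toℕ<n i) (Fin.toℕ<n j) e)) y
    in toℕ i , sym e

  -- The negated universal statement yields witnesses through two nested finite searches.
  noncommutingPair : NonAbelian G → ∃₂ λ x y → ¬ (x ∙ y ≈ y ∙ x)
  noncommutingPair nonAbelian = [ ⊥-elim ∘ nonAbelian , from ]′
    (∀⊎∃¬ (λ x≈x′ h y → trans (∙-congʳ (sym x≈x′)) (trans (h y) (∙-congˡ x≈x′)))
      (λ x → [ yes , (λ (y , xy≉yx) → no λ h → xy≉yx (h y)) ]′ (commutesWithAll? x)))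
    where
    commutesWithAll? : ∀ x → (∀ y → x ∙ y ≈ y ∙ x) ⊎ (∃ λ y → ¬ (x ∙ y ≈ y ∙ x))
    commutesWithAll? x = ∀⊎∃¬
      (λ y≈y′ h → trans (∙-congˡ (sym y≈y′)) (trans h (∙-congʳ y≈y′)))
      (λ y → x ∙ y ≟ y ∙ x)

    from : (∃ λ x → ¬ (∀ y → x ∙ y ≈ y ∙ x)) → ∃₂ λ x y → ¬ (x ∙ y ≈ y ∙ x)
    from (x , ¬central) = x , [ ⊥-elim ∘ ¬central , id ]′ (commutesWithAll? x)

-- Groups of order 3p with an element of order p.

-- The pair (i , j) stands for x ^ i ∙ y ^ j in ⟨ x , y ∣ xᵖ = y³ = ε, y x = xʳ y ⟩.
metacyclic : (p r : ℕ) .{{_ : NonZero p}} → RawGroup 0ℓ 0ℓ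
metacyclic p r = record
  { Carrier = Fin p × Fin 3
  ; _≈_     = _≡_
  ; _∙_     = λ (i , j) (i′ , j′) → (toℕ i + r ℕ.^ toℕ j * toℕ i′) mod p , (toℕ j + toℕ j′) mod 3
  ; ε       = 0 mod p , zero
  ; _⁻¹     = λ (i , j) → (r ℕ.^ (3 ∸ toℕ j) * (p ∸ toℕ i)) mod p , (3 ∸ toℕ j) mod 3
  }

-- (xᵗ y)³ = x ^ cubeExponent r t ∙ y³ if y x = xʳ y.
cubeExponent : ℕ → ℕ → ℕ
cubeExponent r t = t + r ℕ.^ 1 * (t + r ℕ.^ 1 * (t + r ℕ.^ 1 * 0))

-- The numerical hypotheses are finite checks, later evaluated for p = 9 and p = 13. `cubeRoots` is
-- what allows r to be normalised to `r₀`, and `cubes` what allows y³ to be normalised to ε.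
module CyclicOfIndexThree
  (G : Group c ℓ) {k : ℕ} (enum : HasOrder G (suc k)) (nonAbelian : NonAbelian G)
  {p : ℕ} .{{_ : NonZero p}} (p*3≡n : p * 3 ≡ suc k)
  (divisors : ∀ {d} → d ∣ suc k → d ∣ 3 ⊎ d ≡ p ⊎ d ≡ suc k)
  (2⊥p : gcd 2 p ≡ 1) (2⊥n : gcd 2 (suc k) ≡ 1)
  (r₀ : ℕ)
  (cubeRoots : ∀ (r : Fin p) → toℕ r ℕ.^ 3 % p ≡ 1 % p →
    toℕ r % p ≡ 1 % p ⊎ toℕ r % p ≡ r₀ % p ⊎ toℕ r ℕ.^ 2 % p ≡ r₀ % p)
  (cubes : ∀ (s : Fin p) → toℕ s * r₀ % p ≡ toℕ s % p →
    ∃ λ (t : Fin p) → (cubeExponent r₀ (toℕ t) + toℕ s) % p ≡ 0 % p)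
  where
  open Group G
  open FiniteGroup G enum
  open import Algebra.Properties.Group G 
    using (∙-cancelʳ; inverseˡ-unique; ⁻¹-anti-homo-∙)
  open import Relation.Binary.Reasoning.Setoid setoid

  module _ {x : Carrier} (o : Order x p) where
    open Order o

    -- Only j = 2 needs an argument: w² and wᵐ = ε both lying in ⟨x⟩ would put w there, as 2 and m
    -- are coprime. For a conjugate of x, m is p; for an arbitrary y it is the order of G.
    squares-outside : ∀ {w} m → gcd 2 m ≡ 1 → w ^ m ≈ ε → ¬ (w ∈⟨ x ⟩) →
                      ∀ j → 0 < j → j < 3 → ¬ (w ^ j ∈⟨ x ⟩)
    squares-outside {w} m 2⊥m wᵐ≈ε w∉ 1 _ _ w¹∈ = w∉ (∈-resp (^-one w) w¹∈)
    squares-outside {w} m 2⊥m wᵐ≈ε w∉ 2 _ _ w²∈ = w∉ (∈-resp (trans (^-congʳ w 2⊥m) (^-one w))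
      (∈-gcd 2 m w²∈ (0 , trans wᵐ≈ε (sym (^-zero x)))))
    squares-outside m 2⊥m wᵐ≈ε w∉ (suc (suc (suc _))) _ (s<s (s<s (s<s ())))

    -- The 3p products are distinct and G has exactly 3p elements.
    covering : ∀ {w} → (∀ j → 0 < j → j < 3 → ¬ (w ^ j ∈⟨ x ⟩)) →
               ∀ y → ∃ λ ((i , j) : Fin p × Fin 3) → x ^ toℕ i ∙ w ^ toℕ j ≈ y
    covering outside y =
      let i , e = injective⇒surjective p*3≡n
            (remQuot-injective {p} 3 ∘ products-injective o outside) y
      in remQuot {p} 3 i , e

    -- Otherwise G = ⟨x⟩ ⟨w⟩ for w = y x y⁻¹, so y⁻¹ = xⁱ y xʲ y⁻¹ for some i and j,
    -- whence y ∈ ⟨x⟩.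
    normal : ∀ y → ∃ λ r → y ∙ x ≈ x ^ r ∙ y
    normal y = by-cases (w ∈?⟨ x ⟩)
      where
      w : Carrier
      w = y ∙ x ∙ y ⁻¹

      yx≈wy : y ∙ x ≈ w ∙ y
      yx≈wy = sym (trans (assoc _ _ _) (trans (∙-congˡ (inverseˡ y)) (identityʳ _)))

      wᵖ≈ε : w ^ p ≈ ε
      wᵖ≈ε = ∙-cancelʳ y _ _ (begin
        w ^ p ∙ y  ≈⟨ intertwine-^ yx≈wy p ⟨
        y ∙ x ^ p  ≈⟨ ∙-congˡ ^-order ⟩
        y ∙ ε      ≈⟨ identityʳ y ⟩
        y          ≈⟨ identityˡ y ⟨
        ε ∙ y      ∎)

      w∉⇒y∈ : ¬ (w ∈⟨ x ⟩) → y ∈⟨ x ⟩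
      w∉⇒y∈ w∉ = let (i , j) , e = covering (squares-outside p 2⊥p wᵖ≈ε w∉) (y ⁻¹) in
        ∈-cancelʳ (toℕ j , refl) (∈-cancelˡ (toℕ i , refl) (0 , (begin
          x ^ toℕ i ∙ (y ∙ x ^ toℕ j)  ≈⟨ ∙-congˡ (intertwine-^ yx≈wy (toℕ j)) ⟩
          x ^ toℕ i ∙ (w ^ toℕ j ∙ y)  ≈⟨ assoc _ _ _ ⟨
          x ^ toℕ i ∙ w ^ toℕ j ∙ y    ≈⟨ ∙-congʳ e ⟩
          y ⁻¹ ∙ y                     ≈⟨ inverseˡ y ⟩
          ε                            ≈⟨ ^-zero x ⟨
          x ^ 0                        ∎)))

      by-cases : Dec (w ∈⟨ x ⟩) → ∃ λ r → y ∙ x ≈ x ^ r ∙ y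
      by-cases (yes (r , w≈xʳ)) = r , trans yx≈wy (∙-congʳ w≈xʳ)
      by-cases (no w∉) = contradiction (∈-∙ (∈-∙ y∈ (1 , sym (^-one x))) (∈-⁻¹ y∈)) w∉
        where
        y∈ : y ∈⟨ x ⟩
        y∈ = w∉⇒y∈ w∉

    module Outside {y : Carrier} (y∉ : ¬ (y ∈⟨ x ⟩)) where
      y-outside : ∀ j → 0 < j → j < 3 → ¬ (y ^ j ∈⟨ x ⟩)
      y-outside = squares-outside (suc k) 2⊥n (^-cardinality y) y∉

      -- Every element is a product xⁱ yʲ, so G would be commutative if x and y commuted.
      noncommuting : ¬ (y ∙ x ≈ x ∙ y)
      noncommuting yx≈xy = nonAbelian λ g h →
        let (i , j) , e = covering y-outside g
            (i′ , j′) , e′ = covering y-outside h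
        in begin
          g ∙ h
            ≈⟨ ∙-cong e e′ ⟨
          (x ^ toℕ i ∙ y ^ toℕ j) ∙ (x ^ toℕ i′ ∙ y ^ toℕ j′)
            ≈⟨ product (toℕ i) (toℕ j) (toℕ i′) (toℕ j′) ⟩
          x ^ (toℕ i + toℕ i′) ∙ y ^ (toℕ j + toℕ j′)
            ≈⟨ ∙-cong (^-congʳ x (ℕ.+-comm (toℕ i) (toℕ i′))) (^-congʳ y (ℕ.+-comm (toℕ j) (toℕ j′))) ⟩
          x ^ (toℕ i′ + toℕ i) ∙ y ^ (toℕ j′ + toℕ j)
            ≈⟨ product (toℕ i′) (toℕ j′) (toℕ i) (toℕ j) ⟨
          (x ^ toℕ i′ ∙ y ^ toℕ j′) ∙ (x ^ toℕ i ∙ y ^ toℕ j)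
            ≈⟨ ∙-cong e′ e ⟩
          h ∙ g ∎
        where
        product : ∀ a j b l → (x ^ a ∙ y ^ j) ∙ (x ^ b ∙ y ^ l) ≈ x ^ (a + b) ∙ y ^ (j + l)
        product a j b l = trans
          (normalForm-∙ (trans yx≈xy (∙-congʳ (sym (^-one x)))) a j b l)
          (∙-congʳ (^-congʳ x (≡.cong (a +_)
            (≡.trans (≡.cong (_* b) (ℕ.^-zeroˡ j)) (ℕ.*-identityˡ b)))))

      abstract
        -- Write y³ = xⁱ yʲ with j < 3. If j were 1 or 2, cancelling yʲ would put y² or y in ⟨x⟩.
        cube∈ : y ^ 3 ∈⟨ x ⟩
        cube∈ = let (i , j) , e = covering y-outside (y ^ 3) in from (toℕ i) j e
          where
          lower : ∀ i j j′ → 0 < j′ → j′ < 3 → j′ + j ≡ 3 → ¬ (x ^ i ∙ y ^ j ≈ y ^ 3)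
          lower i j j′ 0<j′ j′<3 j′+j≡3 e = y-outside j′ 0<j′ j′<3 (i , ∙-cancelʳ (y ^ j) _ _
            (trans (sym (^-homo-+ y j′ j)) (trans (^-congʳ y j′+j≡3) (sym e))))

          from : ∀ i (j : Fin 3) → x ^ i ∙ y ^ toℕ j ≈ y ^ 3 → y ^ 3 ∈⟨ x ⟩
          from i zero             e = i , trans (sym e) (trans (∙-congˡ (^-zero y)) (identityʳ _))
          from i (suc zero)       e = ⊥-elim (lower i 1 2 (s≤s z≤n) (s≤s (s≤s (s≤s z≤n))) ≡.refl e)
          from i (suc (suc zero)) e = ⊥-elim (lower i 2 1 (s≤s z≤n) (s≤s (s≤s z≤n)) ≡.refl e)

      module _ {r : ℕ} (yx≈xʳy : y ∙ x ≈ x ^ r ∙ y) where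
        -- As a power of x, y³ commutes with x; on the other hand, moving y³ past x raises x to the
        -- power r³.
        r³≡1 : r ℕ.^ 3 % p ≡ 1 % p
        r³≡1 = ^-injective-% (∙-cancelʳ (y ^ 3) _ _ (begin
          x ^ (r ℕ.^ 3) ∙ y ^ 3      ≈⟨ ∙-congʳ (^-congʳ x (ℕ.*-identityʳ (r ℕ.^ 3))) ⟨
          x ^ (r ℕ.^ 3 * 1) ∙ y ^ 3  ≈⟨ intertwine-^-^ yx≈xʳy 3 1 ⟨
          y ^ 3 ∙ x ^ 1              ≈⟨ ∈⟨⟩-commute cube∈ (1 , refl) ⟩
          x ^ 1 ∙ y ^ 3              ∎))

        -- y commutes with its own cube xˢ, while moving y past xˢ multiplies the exponent by r.
        sr≡s : ∀ s → y ^ 3 ≈ x ^ s → s * r % p ≡ s % p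
        sr≡s s y³≈xˢ = ^-injective-% (∙-cancelʳ y _ _ (begin
          x ^ (s * r) ∙ y    ≈⟨ ∙-congʳ (^-assoc x r s) ⟨
          (x ^ r) ^ s ∙ y    ≈⟨ intertwine-^ yx≈xʳy s ⟨
          y ∙ x ^ s          ≈⟨ ∙-congˡ y³≈xˢ ⟨
          y ∙ y ^ 3          ≈⟨ intertwine-^ {y} {y} {y} refl 3 ⟩
          y ^ 3 ∙ y          ≈⟨ ∙-congʳ y³≈xˢ ⟩
          x ^ s ∙ y          ∎))

    outside : ∃ λ y → ¬ (y ∈⟨ x ⟩)
    outside with ∀⊎∃¬ ∈-resp (_∈?⟨ x ⟩)
    ... | inj₁ all = ⊥-elim (nonAbelian λ g h → ∈⟨⟩-commute (all g) (all h))
    ... | inj₂ ∃y  = ∃y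

    outside-r₀ : ∃ λ y → ¬ (y ∈⟨ x ⟩) × y ∙ x ≈ x ^ r₀ ∙ y
    outside-r₀ =
      let y , y∉ = outside
          r , yx≈xʳy = normal y
      in from y∉ (r mod p) (trans yx≈xʳy (∙-congʳ (sym (^-mod ^-order r))))
      where
      from : ∀ {y} → ¬ (y ∈⟨ x ⟩) → (r : Fin p) → y ∙ x ≈ x ^ toℕ r ∙ y →
             ∃ λ y → ¬ (y ∈⟨ x ⟩) × y ∙ x ≈ x ^ r₀ ∙ y
      from {y} y∉ r yx≈xʳy with cubeRoots r (Outside.r³≡1 y∉ yx≈xʳy)
      ... | inj₁ r≡1 = ⊥-elim (Outside.noncommuting y∉
              (trans yx≈xʳy (∙-congʳ (trans (^-cong-% ^-order r≡1) (^-one x)))))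
      ... | inj₂ (inj₁ r≡r₀) = y , y∉ , trans yx≈xʳy (∙-congʳ (^-cong-% ^-order r≡r₀))
      ... | inj₂ (inj₂ r²≡r₀) =
        y ^ 2 , Outside.y-outside y∉ 2 (s≤s z≤n) (s≤s (s≤s (s≤s z≤n))) , (begin
          y ^ 2 ∙ x                      ≈⟨ ∙-congˡ (^-one x) ⟨
          y ^ 2 ∙ x ^ 1                  ≈⟨ intertwine-^-^ yx≈xʳy 2 1 ⟩
          x ^ (toℕ r ℕ.^ 2 * 1) ∙ y ^ 2  ≈⟨ ∙-congʳ (^-congʳ x (ℕ.*-identityʳ (toℕ r ℕ.^ 2))) ⟩
          x ^ (toℕ r ℕ.^ 2) ∙ y ^ 2      ≈⟨ ∙-congʳ (^-cong-% ^-order r²≡r₀) ⟩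
          x ^ r₀ ∙ y ^ 2                 ∎)

    -- With y³ = xˢ, the cube of xᵗ y is x to the power `cubeExponent r₀ t + s`. By `sr≡s` the
    -- premise of `cubes` holds, and it supplies a t for which p divides this exponent.
    complement : ∃ λ y → ¬ (y ∈⟨ x ⟩) × y ∙ x ≈ x ^ r₀ ∙ y × y ^ 3 ≈ ε
    complement =
      let y , y∉ , yx≈xʳy = outside-r₀
          s , y³≈xˢ = Outside.cube∈ y∉
      in from y∉ yx≈xʳy (s mod p) (trans y³≈xˢ (sym (^-mod ^-order s)))
      where
      from : ∀ {y} → ¬ (y ∈⟨ x ⟩) → y ∙ x ≈ x ^ r₀ ∙ y → (s : Fin p) → y ^ 3 ≈ x ^ toℕ s →
             ∃ λ y → ¬ (y ∈⟨ x ⟩) × y ∙ x ≈ x ^ r₀ ∙ y × y ^ 3 ≈ ε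
      from {y} y∉ yx≈xʳy s y³≈xˢ =
        let t , e = cubes s (Outside.sr≡s y∉ yx≈xʳy (toℕ s) y³≈xˢ) in
        adjust (toℕ t) ,
        (λ u∈ → y∉ (∈-resp (^-one y) (∈-cancelˡ (toℕ t , refl) u∈))) ,
        commutation (toℕ t) ,
        cubed (toℕ t) e
        where
        adjust : ℕ → Carrier
        -- The exponent 1 is kept so that `normalForm-∙` applies literally; this is where the
        -- factors `r ℕ.^ 1` in `cubeExponent` come from.
        adjust t = x ^ t ∙ y ^ 1

        commutation : ∀ t → adjust t ∙ x ≈ x ^ r₀ ∙ adjust t
        commutation t = begin
          x ^ t ∙ y ^ 1 ∙ x       ≈⟨ assoc _ _ _ ⟩
          x ^ t ∙ (y ^ 1 ∙ x)     ≈⟨ ∙-congˡ (∙-congʳ (^-one y)) ⟩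
          x ^ t ∙ (y ∙ x)         ≈⟨ ∙-congˡ yx≈xʳy ⟩
          x ^ t ∙ (x ^ r₀ ∙ y)    ≈⟨ assoc _ _ _ ⟨
          x ^ t ∙ x ^ r₀ ∙ y      ≈⟨ ∙-cong (commute-^ {x} {x} refl t r₀) (sym (^-one y)) ⟩
          x ^ r₀ ∙ x ^ t ∙ y ^ 1  ≈⟨ assoc _ _ _ ⟩
          x ^ r₀ ∙ adjust t       ∎

        cubed : ∀ t → (cubeExponent r₀ t + toℕ s) % p ≡ 0 % p → adjust t ^ 3 ≈ ε
        cubed t e = begin
          adjust t ^ 3                       ≈⟨ power 2 _ 2 (power 1 _ 1 (power 0 0 0 power-zero)) ⟩
          x ^ cubeExponent r₀ t ∙ y ^ 3      ≈⟨ ∙-congˡ y³≈xˢ ⟩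
          x ^ cubeExponent r₀ t ∙ x ^ toℕ s  ≈⟨ ^-homo-+ x _ (toℕ s) ⟨
          x ^ (cubeExponent r₀ t + toℕ s)    ≈⟨ ^-cong-% ^-order e ⟩
          x ^ 0                              ≈⟨ ^-zero x ⟩
          ε                                  ∎
          where
          power-zero : adjust t ^ 0 ≈ x ^ 0 ∙ y ^ 0
          power-zero = trans (^-zero _)
            (sym (trans (∙-cong (^-zero x) (^-zero y)) (identityʳ ε)))

          power : ∀ m a j → adjust t ^ m ≈ x ^ a ∙ y ^ j →
                  adjust t ^ suc m ≈ x ^ (t + r₀ ℕ.^ 1 * a) ∙ y ^ suc j
          power m a j e = trans (^-suc _ m) (trans (∙-congˡ e) (normalForm-∙ yx≈xʳy t 1 a j))

    -- The model multiplies as `normalForm-∙` does, with exponents reduced modulo p and 3, which xᵖ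
    -- = y³ = ε permits. Counting the products xⁱ yʲ gives bijectivity.
    isomorphism : ∃ λ φ → IsGroupIsomorphism (metacyclic p r₀) rawGroup φ
    isomorphism = φ , record
      { isGroupMonomorphism = record
        { isGroupHomomorphism = record
          { isMonoidHomomorphism = record
            { isMagmaHomomorphism = record
              { isRelHomomorphism = record { cong = λ e → reflexive (≡.cong φ e) }
              ; homo = λ (i , j) (i′ , j′) → trans
                  (∙-cong (^-mod ^-order _) (^-mod y³≈ε _))
                  (sym (normalForm-∙ yx≈xʳy (toℕ i) (toℕ j) (toℕ i′) (toℕ j′)))
              }
            ; ε-homo = trans (∙-cong (trans (^-mod ^-order 0) (^-zero x)) (^-zero y)) (identityˡ ε)
            }
          ; ⁻¹-homo = ⁻¹-homo
          }
        ; injective = products-injective o (Outside.y-outside y∉)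
        }
      ; surjective = λ g → let u , e = covering (Outside.y-outside y∉) g in
          u , λ { ≡.refl → e }
      }
      where
      y = proj₁ complement
      y∉ = proj₁ (proj₂ complement)
      yx≈xʳy = proj₁ (proj₂ (proj₂ complement))
      y³≈ε = proj₂ (proj₂ (proj₂ complement))

      φ : Fin p × Fin 3 → Carrier
      φ (i , j) = x ^ toℕ i ∙ y ^ toℕ j

      ⁻¹-homo : ∀ u → φ (RawGroup._⁻¹ (metacyclic p r₀) u) ≈ φ u ⁻¹
      ⁻¹-homo (i , j) = begin
        φ (RawGroup._⁻¹ (metacyclic p r₀) (i , j))
          ≈⟨ ∙-cong (^-mod ^-order _) (^-mod y³≈ε _) ⟩
        x ^ (r₀ ℕ.^ (3 ∸ toℕ j) * (p ∸ toℕ i)) ∙ y ^ (3 ∸ toℕ j)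
          ≈⟨ intertwine-^-^ yx≈xʳy (3 ∸ toℕ j) (p ∸ toℕ i) ⟨
        y ^ (3 ∸ toℕ j) ∙ x ^ (p ∸ toℕ i)
          ≈⟨ ∙-cong (inverseˡ-unique _ _ (^-complement y³≈ε (ℕ.<⇒≤ (Fin.toℕ<n j))))
                    (inverseˡ-unique _ _ (^-complement ^-order (ℕ.<⇒≤ (Fin.toℕ<n i)))) ⟩
        (y ^ toℕ j) ⁻¹ ∙ (x ^ toℕ i) ⁻¹
          ≈⟨ ⁻¹-anti-homo-∙ _ _ ⟨
        φ (i , j) ⁻¹ ∎

  -- An element whose cube is not ε has order p or 3p by Lagrange, and order 3p would make G cyclic,
  -- hence commutative.
  exponentThree⊎metacyclic :
    (∀ g → g ^ 3 ≈ ε) ⊎ (∃ λ φ → IsGroupIsomorphism (metacyclic p r₀) rawGroup φ)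
  exponentThree⊎metacyclic = Sum.map₂ from
    (∀⊎∃¬ (λ g≈h e → trans (^-congˡ 3 (sym g≈h)) e) (λ g → g ^ 3 ≟ ε))
    where
    from : (∃ λ x → ¬ (x ^ 3 ≈ ε)) → ∃ λ φ → IsGroupIsomorphism (metacyclic p r₀) rawGroup φ
    from (x , x³≉ε) = let d , d∣n , o = order x in by-cases o (divisors d∣n)
      where
      by-cases : ∀ {d} → Order x d → d ∣ 3 ⊎ d ≡ p ⊎ d ≡ suc k → _
      by-cases o (inj₁ d∣3)           = ⊥-elim (x³≉ε (^-∣ (Order.^-order o) d∣3))
      by-cases o (inj₂ (inj₁ ≡.refl)) = isomorphism o
      by-cases o (inj₂ (inj₂ ≡.refl)) = ⊥-elim (nonAbelian λ g h →
        ∈⟨⟩-commute (full-order⇒generator o g) (full-order⇒generator o h))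

-- Groups of exponent 3 and the Heisenberg group of order 27.

-- The triple (i , j , k) stands for x ^ i ∙ y ^ j ∙ z ^ k, where y x = x y z and z is central.
heisenberg : RawGroup 0ℓ 0ℓ
heisenberg = record
  { Carrier = Fin 3 × Fin 3 × Fin 3
  ; _≈_     = _≡_
  ; _∙_     = λ (i , j , k) (i′ , j′ , k′) →
      (toℕ i + toℕ i′) mod 3 , (toℕ j + toℕ j′) mod 3 ,
      (toℕ j * toℕ i′ + (toℕ k + toℕ k′)) mod 3
  ; ε       = zero , zero , zero
  ; _⁻¹     = λ (i , j , k) →
      (3 ∸ toℕ i) mod 3 , (3 ∸ toℕ j) mod 3 , (toℕ i * toℕ j + (3 ∸ toℕ k)) mod 3
  }

module Heisenberg where
  open RawGroup heisenberg public

  infix 4 _≟_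
  _≟_ : DecidableEquality Carrier
  _≟_ = ≡-dec Fin._≟_ (≡-dec Fin._≟_ Fin._≟_)

  inverseʳ : ∀ i j k → (i , j , k) ∙ (i , j , k) ⁻¹ ≡ ε
  inverseʳ = from-yes (Fin.all? λ i → Fin.all? λ j → Fin.all? λ k →
    (i , j , k) ∙ (i , j , k) ⁻¹ ≟ ε)

  -- Checked by evaluation on all pairs, because the raw model carries no group laws. It turns a
  -- trivial kernel into injectivity.
  ∙⁻¹≡ε⇒≡ : ∀ i j k i′ j′ k′ →
    (i , j , k) ∙ (i′ , j′ , k′) ⁻¹ ≡ ε → (i , j , k) ≡ (i′ , j′ , k′)
  ∙⁻¹≡ε⇒≡ = from-yes (Fin.all? λ i → Fin.all? λ j → Fin.all? λ k →
    Fin.all? λ i′ → Fin.all? λ j′ → Fin.all? λ k′ →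
    ((i , j , k) ∙ (i′ , j′ , k′) ⁻¹ ≟ ε) →-dec ((i , j , k) ≟ (i′ , j′ , k′)))

module ExponentThree (G : Group c ℓ)
  (g³≈ε : ∀ g → Group._≈_ G (Powers._^_ G g 3) (Group.ε G)) where
  open Group G
  open Powers G
  open import Algebra.Properties.Group G using (∙-cancelˡ; ∙-cancelʳ; inverseʳ-unique)
  open import Algebra.Properties.Semigroup semigroup using (uv≈wx⇒u∙vy≈w∙xy)
  open import Relation.Binary.Reasoning.Setoid setoid

  private
    cube : ∀ g → g ∙ g ∙ g ≈ ε
    cube g = trans (sym (^-three g)) (g³≈ε g)

  -- In exponent 3 squares are inverses, so this is the rule (x y)⁻¹ = y⁻¹ x⁻¹.
  [xy]² : ∀ x y → x ∙ y ∙ (x ∙ y) ≈ y ∙ y ∙ (x ∙ x)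
  [xy]² x y = ∙-cancelʳ (x ∙ y) _ _ (begin
    x ∙ y ∙ (x ∙ y) ∙ (x ∙ y)    ≈⟨ cube (x ∙ y) ⟩
    ε                            ≈⟨ cube y ⟨
    y ∙ y ∙ y                    ≈⟨ ∙-congʳ (identityʳ _) ⟨
    y ∙ y ∙ ε ∙ y                ≈⟨ ∙-congʳ (∙-congˡ (cube x)) ⟨
    y ∙ y ∙ (x ∙ x ∙ x) ∙ y      ≈⟨ solve monoid ⟩
    y ∙ y ∙ (x ∙ x) ∙ (x ∙ y)    ∎)

  -- c is the conjugate y x y⁻¹.
  conjugates-commute : ∀ x y → let c = y ∙ x ∙ (y ∙ y) in x ∙ c ≈ c ∙ x
  conjugates-commute x y = begin
    x ∙ (y ∙ x ∙ (y ∙ y))       ≈⟨ solve monoid ⟩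
    x ∙ y ∙ (x ∙ y) ∙ y         ≈⟨ ∙-congʳ ([xy]² x y) ⟩
    y ∙ y ∙ (x ∙ x) ∙ y         ≈⟨ solve monoid ⟩
    -- The claim inside is y x² y = x y² x. Multiplied by y² on the right and simplified with y³ =
    -- ε, it becomes `[xy]²` for x and y².
    y ∙ (y ∙ x ∙ x ∙ y)         ≈⟨ ∙-congˡ (∙-cancelʳ (y ∙ y) _ _ (begin
      y ∙ x ∙ x ∙ y ∙ (y ∙ y)             ≈⟨ solve monoid ⟩
      y ∙ x ∙ x ∙ (y ∙ y ∙ y)             ≈⟨ ∙-congˡ (cube y) ⟩
      y ∙ x ∙ x ∙ ε                       ≈⟨ ∙-congʳ (∙-congʳ (∙-congʳ (sym (trans (∙-congʳ (cube y)) (identityˡ y))))) ⟩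
      y ∙ y ∙ y ∙ y ∙ x ∙ x ∙ ε           ≈⟨ solve monoid ⟩
      (y ∙ y) ∙ (y ∙ y) ∙ (x ∙ x)         ≈⟨ [xy]² x (y ∙ y) ⟨
      x ∙ (y ∙ y) ∙ (x ∙ (y ∙ y))         ≈⟨ solve monoid ⟩
      x ∙ y ∙ y ∙ x ∙ (y ∙ y)             ∎)) ⟩
    y ∙ (x ∙ y ∙ y ∙ x)         ≈⟨ solve monoid ⟩
    y ∙ x ∙ (y ∙ y) ∙ x         ∎

  module NonCommuting (x y : Carrier) (xy≉yx : ¬ (x ∙ y ≈ y ∙ x)) where
    -- The commutator y⁻¹ x⁻¹ y x.
    z : Carrier
    z = y ∙ y ∙ (x ∙ x) ∙ (y ∙ x)

    yx≈xyz : y ∙ x ≈ x ∙ (y ∙ z)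
    yx≈xyz = begin
      y ∙ x                                          ≈⟨ identityˡ _ ⟨
      ε ∙ (y ∙ x)                                    ≈⟨ ∙-congʳ (cube x) ⟨
      x ∙ x ∙ x ∙ (y ∙ x)                            ≈⟨ ∙-congʳ (∙-congʳ (∙-congʳ (trans (∙-congˡ (cube y)) (identityʳ x)))) ⟨
      x ∙ (y ∙ y ∙ y) ∙ x ∙ x ∙ (y ∙ x)              ≈⟨ solve monoid ⟩
      x ∙ (y ∙ (y ∙ y ∙ (x ∙ x) ∙ (y ∙ x)))          ∎

    -- z = x q x, where q = y x y⁻¹ is a conjugate of x and so commutes with x.
    zx≈xz : z ∙ x ≈ x ∙ z
    zx≈xz = begin
      z ∙ x                          ≈⟨ ∙-congʳ z≈xqx ⟩
      x ∙ q ∙ x ∙ x                  ≈⟨ ∙-congʳ (trans (assoc _ _ _) (∙-congˡ (sym (conjugates-commute x y)))) ⟩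
      x ∙ (x ∙ q) ∙ x                ≈⟨ assoc _ _ _ ⟩
      x ∙ (x ∙ q ∙ x)                ≈⟨ ∙-congˡ z≈xqx ⟨
      x ∙ z                          ∎
      where
      q : Carrier
      q = y ∙ x ∙ (y ∙ y)

      z≈xqx : z ≈ x ∙ q ∙ x
      z≈xqx = begin
        y ∙ y ∙ (x ∙ x) ∙ (y ∙ x)          ≈⟨ ∙-congʳ ([xy]² x y) ⟨
        x ∙ y ∙ (x ∙ y) ∙ (y ∙ x)          ≈⟨ solve monoid ⟩
        x ∙ (y ∙ x ∙ (y ∙ y)) ∙ x          ∎

    -- z = y² q, where q = x⁻¹ y x is a conjugate of y and so commutes with y. The form of q matches
    -- `conjugates-commute` with x² = x⁻¹ as the conjugating element.
    zy≈yz : z ∙ y ≈ y ∙ z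
    zy≈yz = begin
      z ∙ y                          ≈⟨ ∙-congʳ z≈yyq ⟩
      y ∙ y ∙ q ∙ y                  ≈⟨ trans (assoc _ _ _) (∙-congˡ (sym (conjugates-commute y (x ∙ x)))) ⟩
      y ∙ y ∙ (y ∙ q)                ≈⟨ trans (sym (assoc _ _ _)) (trans (∙-congʳ (assoc _ _ _)) (assoc _ _ _)) ⟩
      y ∙ (y ∙ y ∙ q)                ≈⟨ ∙-congˡ z≈yyq ⟨
      y ∙ z                          ∎
      where
      q : Carrier
      q = x ∙ x ∙ y ∙ (x ∙ x ∙ (x ∙ x))

      z≈yyq : z ≈ y ∙ y ∙ q
      z≈yyq = begin
        y ∙ y ∙ (x ∙ x) ∙ (y ∙ x)                  ≈⟨ ∙-congˡ (∙-congˡ (trans (∙-congʳ (cube x)) (identityˡ x))) ⟨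
        y ∙ y ∙ (x ∙ x) ∙ (y ∙ (x ∙ x ∙ x ∙ x))    ≈⟨ solve monoid ⟩
        y ∙ y ∙ (x ∙ x ∙ y ∙ (x ∙ x ∙ (x ∙ x)))    ∎

    z≉ε : ¬ (z ≈ ε)
    z≉ε z≈ε = xy≉yx (sym (trans yx≈xyz (∙-congˡ (trans (∙-congˡ z≈ε) (identityʳ y)))))

    zʲ≈ε⇒j≡0 : ∀ (j : Fin 3) → z ^ toℕ j ≈ ε → j ≡ zero
    zʲ≈ε⇒j≡0 zero             _    = ≡.refl
    zʲ≈ε⇒j≡0 (suc zero)       z≈ε  = ⊥-elim (z≉ε (trans (sym (^-one z)) z≈ε))
    zʲ≈ε⇒j≡0 (suc (suc zero)) z²≈ε = ⊥-elim (z≉ε (begin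
      z          ≈⟨ identityʳ z ⟨
      z ∙ ε      ≈⟨ ∙-congˡ z²≈ε ⟨
      z ∙ z ^ 2  ≈⟨ ^-suc z 2 ⟨
      z ^ 3      ≈⟨ g³≈ε z ⟩
      ε          ∎))

    -- Since z commutes with x and y, y x = (x z) y gives y xⁱ = xⁱ (y zⁱ). Read as a rule for
    -- moving xⁱ past y zⁱ, this extends to the j-th power.
    yʲxⁱ : ∀ j i → y ^ j ∙ x ^ i ≈ x ^ i ∙ (y ^ j ∙ z ^ (j * i))
    yʲxⁱ j i = begin
      y ^ j ∙ x ^ i                    ≈⟨ intertwine-^ xⁱyzⁱ j ⟨
      x ^ i ∙ (y ∙ z ^ i) ^ j          ≈⟨ ∙-congˡ (∙-^ (sym (intertwine-^ (sym zy≈yz) i)) j) ⟩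
      x ^ i ∙ (y ^ j ∙ (z ^ i) ^ j)    ≈⟨ ∙-congˡ (∙-congˡ (^-assoc z i j)) ⟩
      x ^ i ∙ (y ^ j ∙ z ^ (j * i))    ∎
      where
      xⁱyzⁱ : x ^ i ∙ (y ∙ z ^ i) ≈ y ∙ x ^ i
      xⁱyzⁱ = begin
        x ^ i ∙ (y ∙ z ^ i)    ≈⟨ ∙-congˡ (intertwine-^ (sym zy≈yz) i) ⟩
        x ^ i ∙ (z ^ i ∙ y)    ≈⟨ assoc _ _ _ ⟨
        x ^ i ∙ z ^ i ∙ y      ≈⟨ ∙-congʳ (∙-^ zx≈xz i) ⟨
        (x ∙ z) ^ i ∙ y        ≈⟨ intertwine-^ (trans yx≈xyz (trans (∙-congˡ (sym zy≈yz)) (sym (assoc _ _ _)))) i ⟨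
        y ∙ x ^ i              ∎

    word : ℕ → ℕ → ℕ → Carrier
    word i j k = x ^ i ∙ (y ^ j ∙ z ^ k)

    -- Powers of z move freely; only moving yʲ past the second power of x costs a factor, namely
    -- `z ^ (j * i′)`.
    word-∙ : ∀ i j k i′ j′ k′ →
      word i j k ∙ word i′ j′ k′ ≈ word (i + i′) (j + j′) (j * i′ + (k + k′))
    word-∙ i j k i′ j′ k′ = begin
      u ∙ (v ∙ w) ∙ (u′ ∙ (v′ ∙ w′))      ≈⟨ reassoc u v w u′ v′ w′ ⟩
      u ∙ (v ∙ (w ∙ (u′ ∙ (v′ ∙ w′))))    ≈⟨ ∙-congˡ (∙-congˡ (uv≈wx⇒u∙vy≈w∙xy (commute-^ zx≈xz k i′) _)) ⟩
      u ∙ (v ∙ (u′ ∙ (w ∙ (v′ ∙ w′))))    ≈⟨ ∙-congˡ (uv≈wx⇒u∙vy≈w∙xy (yʲxⁱ j i′) _) ⟩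
      u ∙ (u′ ∙ (v ∙ t ∙ (w ∙ (v′ ∙ w′))))  ≈⟨ ∙-congˡ (∙-congˡ (∙-congˡ (uv≈wx⇒u∙vy≈w∙xy (commute-^ zy≈yz k j′) _))) ⟩
      u ∙ (u′ ∙ (v ∙ t ∙ (v′ ∙ (w ∙ w′))))  ≈⟨ ∙-congˡ (∙-congˡ (assoc _ _ _)) ⟩
      u ∙ (u′ ∙ (v ∙ (t ∙ (v′ ∙ (w ∙ w′)))))  ≈⟨ ∙-congˡ (∙-congˡ (∙-congˡ (uv≈wx⇒u∙vy≈w∙xy (commute-^ zy≈yz (j * i′) j′) _))) ⟩
      u ∙ (u′ ∙ (v ∙ (v′ ∙ (t ∙ (w ∙ w′)))))  ≈⟨ trans (sym (assoc _ _ _)) (∙-congˡ (sym (assoc _ _ _))) ⟩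
      u ∙ u′ ∙ (v ∙ v′ ∙ (t ∙ (w ∙ w′)))  ≈⟨ ∙-cong (^-homo-+ x i i′) (∙-cong (^-homo-+ y j j′)
                                               (trans (^-homo-+ z (j * i′) (k + k′)) (∙-congˡ (^-homo-+ z k k′)))) ⟨
      word (i + i′) (j + j′) (j * i′ + (k + k′)) ∎
      where
      u = x ^ i; v = y ^ j; w = z ^ k; u′ = x ^ i′; v′ = y ^ j′; w′ = z ^ k′; t = z ^ (j * i′)

      reassoc : ∀ u v w u′ v′ w′ → u ∙ (v ∙ w) ∙ (u′ ∙ (v′ ∙ w′)) ≈ u ∙ (v ∙ (w ∙ (u′ ∙ (v′ ∙ w′))))
      reassoc u v w u′ v′ w′ = solve monoid

    φ : Heisenberg.Carrier → Carrier
    φ (i , j , k) = word (toℕ i) (toℕ j) (toℕ k)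

    φ-ε : φ Heisenberg.ε ≈ ε
    φ-ε = trans (∙-cong (^-zero x) (trans (∙-cong (^-zero y) (^-zero z)) (identityˡ ε))) (identityˡ ε)

    φ-∙ : ∀ u v → φ (u Heisenberg.∙ v) ≈ φ u ∙ φ v
    φ-∙ (i , j , k) (i′ , j′ , k′) = trans
      (∙-cong (^-mod (g³≈ε x) _) (∙-cong (^-mod (g³≈ε y) _) (^-mod (g³≈ε z) _)))
      (sym (word-∙ (toℕ i) (toℕ j) (toℕ k) (toℕ i′) (toℕ j′) (toℕ k′)))

    φ-⁻¹ : ∀ u → φ (u Heisenberg.⁻¹) ≈ φ u ⁻¹
    φ-⁻¹ u@(i , j , k) = inverseʳ-unique (φ u) _ (begin
      φ u ∙ φ (u Heisenberg.⁻¹)           ≈⟨ φ-∙ u (u Heisenberg.⁻¹) ⟨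
      φ (u Heisenberg.∙ u Heisenberg.⁻¹)  ≈⟨ reflexive (≡.cong φ (Heisenberg.inverseʳ i j k)) ⟩
      φ Heisenberg.ε                      ≈⟨ φ-ε ⟩
      ε                                   ∎)

    private
      word-cancel : ∀ {i i′ j j′ k k′ l} → i ≡ i′ → j ≡ j′ → k ≡ l + k′ →
                    word i j k ≈ word i′ j′ k′ → z ^ l ≈ ε
      word-cancel {i} {j = j} {k′ = k′} {l} ≡.refl ≡.refl ≡.refl e = ∙-cancelʳ (z ^ k′) _ _ (begin
        z ^ l ∙ z ^ k′  ≈⟨ ^-homo-+ z l k′ ⟨
        z ^ (l + k′)    ≈⟨ ∙-cancelˡ (y ^ j) _ _ (∙-cancelˡ (x ^ i) _ _ e) ⟩
        z ^ k′          ≈⟨ identityˡ _ ⟨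
        ε ∙ z ^ k′      ∎)

    -- A word equal to ε commutes with x and with y; comparing the exponents of z gives j ≡ 0 and i ≡ 0.
    φ-kernel : ∀ u → φ u ≈ ε → u ≡ Heisenberg.ε
    φ-kernel (i , j , k) φu≈ε = kernel (zʲ≈ε⇒j≡0 i zⁱ≈ε) (zʲ≈ε⇒j≡0 j zʲ≈ε) φu≈ε
      where
      central : ∀ g → word (toℕ i) (toℕ j) (toℕ k) ∙ g ≈ g ∙ word (toℕ i) (toℕ j) (toℕ k)
      central g = trans (∙-congʳ φu≈ε) (trans (identityˡ g) (sym (trans (∙-congˡ φu≈ε) (identityʳ g))))

      zʲ≈ε : z ^ toℕ j ≈ ε
      zʲ≈ε = word-cancel (ℕ.+-comm (toℕ i) 1) (ℕ.+-identityʳ _)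
        (≡.cong₂ _+_ (ℕ.*-identityʳ (toℕ j)) (ℕ.+-identityʳ (toℕ k)))
        (trans (sym (word-∙ (toℕ i) (toℕ j) (toℕ k) 1 0 0))
          (trans (central _) (word-∙ 1 0 0 (toℕ i) (toℕ j) (toℕ k))))

      zⁱ≈ε : z ^ toℕ i ≈ ε
      zⁱ≈ε = word-cancel (≡.sym (ℕ.+-identityʳ (toℕ i))) (ℕ.+-comm 1 (toℕ j))
        (≡.cong₂ _+_ (ℕ.*-identityˡ (toℕ i))
          (≡.sym (≡.trans (≡.cong (_+ (toℕ k + 0)) (ℕ.*-zeroʳ (toℕ j))) (ℕ.+-identityʳ (toℕ k)))))
        (trans (sym (word-∙ 0 1 0 (toℕ i) (toℕ j) (toℕ k)))
          (trans (sym (central _)) (word-∙ (toℕ i) (toℕ j) (toℕ k) 0 1 0)))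

      kernel : ∀ {i j k} → i ≡ zero → j ≡ zero → φ (i , j , k) ≈ ε → (i , j , k) ≡ Heisenberg.ε
      kernel {k = k} ≡.refl ≡.refl e = ≡.cong (λ k → zero , zero , k) (zʲ≈ε⇒j≡0 k (begin
        z ^ toℕ k                      ≈⟨ identityˡ _ ⟨
        ε ∙ z ^ toℕ k                  ≈⟨ ∙-congʳ (^-zero y) ⟨
        y ^ 0 ∙ z ^ toℕ k              ≈⟨ identityˡ _ ⟨
        ε ∙ (y ^ 0 ∙ z ^ toℕ k)        ≈⟨ ∙-congʳ (^-zero x) ⟨
        x ^ 0 ∙ (y ^ 0 ∙ z ^ toℕ k)    ≈⟨ e ⟩
        ε                              ∎))

    φ-isGroupMonomorphism : IsGroupMonomorphism heisenberg rawGroup φ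
    φ-isGroupMonomorphism = record
      { isGroupHomomorphism = record
        { isMonoidHomomorphism = record
          { isMagmaHomomorphism = record
            { isRelHomomorphism = record { cong = λ e → reflexive (≡.cong φ e) }
            ; homo              = φ-∙
            }
          ; ε-homo = φ-ε
          }
        ; ⁻¹-homo = φ-⁻¹
        }
      ; injective = λ {u} {v} φu≈φv → Heisenberg.∙⁻¹≡ε⇒≡ _ _ _ _ _ _
        (φ-kernel (u Heisenberg.∙ v Heisenberg.⁻¹) (begin
          φ (u Heisenberg.∙ v Heisenberg.⁻¹)  ≈⟨ φ-∙ u (v Heisenberg.⁻¹) ⟩
          φ u ∙ φ (v Heisenberg.⁻¹)           ≈⟨ ∙-cong φu≈φv (φ-⁻¹ v) ⟩
          φ v ∙ φ v ⁻¹                        ≈⟨ inverseʳ _ ⟩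
          ε                                   ∎))
      }

-- Checking terraces in explicit models.

module Pullback {R : RawGroup c ℓ} (G : Group c′ ℓ′) {φ : RawGroup.Carrier R → Group.Carrier G}
  (φ-iso : IsGroupIsomorphism R (Group.rawGroup G) φ) where
  private
    module R = RawGroup R

  -- The operations are those of R, so the decision procedures evaluate, while the group laws are
  -- inherited from G along φ.
  pullback : Group _ _
  pullback = record { isGroup = GroupMonomorphism.isGroup
    (IsGroupIsomorphism.isGroupMonomorphism φ-iso) (Group.isGroup G) }

  module _ (_≟_ : Decidable R._≈_) {a : Fin (suc k) → R.Carrier}
           (a-bijective : Bijective _≡_ R._≈_ a) where
    arrangement : Arrangement pullback (suc k)
    arrangement = record
      { to        = a
      ; cong      = λ i≡j → Group.reflexive pullback (≡.cong a i≡j)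
      ; bijective = a-bijective
      }

    open DecidableTerraces pullback _≟_ arrangement
    open IsomorphicTerraces pullback G φ-iso

    narcissistic : True isNarcissistic? → Σ[ 𝐚 ∈ Arrangement G (suc k) ] IsNarcissistic G 𝐚
    narcissistic t = image arrangement , isNarcissistic-image arrangement (toWitness t)

    directedHalfAndHalf : True isDirectedHalfAndHalf? →
                          Σ[ 𝐚 ∈ Arrangement G (suc k) ] IsDirectedHalfAndHalf G 𝐚
    directedHalfAndHalf t = image arrangement , isDirectedHalfAndHalf-image arrangement (toWitness t)

-- The explicit terraces.

distinct? : ∀ {K : Set} → DecidableEquality K → (v : Vec K n) →
            Dec (∀ i j → lookup v i ≡ lookup v j → i ≡ j)
distinct? _≟_ v = Fin.all? λ i → Fin.all? λ j → (lookup v i ≟ lookup v j) →-dec (i Fin.≟ j)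

-- Only distinctness of the entries is evaluated; surjectivity follows by counting against `enum`.
listing : ∀ {K : Set} (_≟_ : DecidableEquality K) → Fin n ⤖ K → (v : Vec K n) →
          True (distinct? _≟_ v) → Fin n ⤖ K
listing {K = K} _≟_ enum v t = mk⤖ {to = lookup v} (injective , λ y →
  let i , e = FiniteSetoid.injective⇒surjective (≡.setoid K) enum ≡.refl injective y
  in i , λ { ≡.refl → e })
  where
  injective : Injective _≡_ _≡_ (lookup v)
  injective = toWitness t _ _

-- x ^ i ∙ y ^ j is coded by 3 i + j.
metacyclicListing : ∀ p .{{_ : NonZero p}} → Vec ℕ n → Vec (Fin p × Fin 3) n
metacyclicListing p = map λ a → (a / 3) mod p , a mod 3

-- x ^ i ∙ y ^ j ∙ z ^ k is coded by 9 i + 3 j + k.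
heisenbergListing : Vec ℕ n → Vec (Fin 3 × Fin 3 × Fin 3) n
heisenbergListing = map λ a → (a / 9) mod 3 , (a / 3) mod 3 , a mod 3

_≟²_ : ∀ {p} → DecidableEquality (Fin p × Fin 3)
_≟²_ = ≡-dec Fin._≟_ Fin._≟_

enum³ : Fin 27 ⤖ (Fin 3 × Fin 3 × Fin 3)
enum³ = ↔⇒⤖ (↔-trans (Fin.*↔× {3} {9}) (↔-refl ×-↔ Fin.*↔× {3} {3}))

heisenberg-narcissistic : Fin 27 ⤖ (Fin 3 × Fin 3 × Fin 3)
heisenberg-narcissistic = listing Heisenberg._≟_ enum³ (heisenbergListing (
  22 ∷ 8 ∷ 1 ∷ 15 ∷ 19 ∷ 14 ∷ 6 ∷ 26 ∷ 7 ∷ 16 ∷ 11 ∷ 10 ∷ 13 ∷ 0 ∷ 24 ∷ 18 ∷ 20 ∷ 21 ∷ 5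
  ∷ 12 ∷ 3 ∷ 25 ∷ 9 ∷ 23 ∷ 2 ∷ 4 ∷ 17 ∷ [])) _

heisenberg-directed : Fin 27 ⤖ (Fin 3 × Fin 3 × Fin 3)
heisenberg-directed = listing Heisenberg._≟_ enum³ (heisenbergListing (
  0 ∷ 7 ∷ 14 ∷ 18 ∷ 26 ∷ 17 ∷ 24 ∷ 13 ∷ 1 ∷ 12 ∷ 6 ∷ 25 ∷ 19 ∷ 20 ∷ 3 ∷ 8 ∷ 16 ∷ 11 ∷ 23
  ∷ 4 ∷ 22 ∷ 15 ∷ 21 ∷ 10 ∷ 9 ∷ 5 ∷ 2 ∷ [])) _

metacyclic27-narcissistic : Fin 27 ⤖ (Fin 9 × Fin 3)
metacyclic27-narcissistic = listing _≟²_ (↔⇒⤖ Fin.*↔×) (metacyclicListing 9 (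
  15 ∷ 9 ∷ 21 ∷ 16 ∷ 14 ∷ 19 ∷ 8 ∷ 26 ∷ 7 ∷ 17 ∷ 10 ∷ 11 ∷ 3 ∷ 0 ∷ 24 ∷ 1 ∷ 2 ∷ 22 ∷ 5 ∷
  13 ∷ 4 ∷ 20 ∷ 25 ∷ 23 ∷ 6 ∷ 18 ∷ 12 ∷ [])) _

metacyclic27-directed : Fin 27 ⤖ (Fin 9 × Fin 3)
metacyclic27-directed = listing _≟²_ (↔⇒⤖ Fin.*↔×) (metacyclicListing 9 (
  0 ∷ 17 ∷ 5 ∷ 4 ∷ 25 ∷ 11 ∷ 13 ∷ 23 ∷ 16 ∷ 24 ∷ 22 ∷ 10 ∷ 19 ∷ 6 ∷ 9 ∷ 1 ∷ 3 ∷ 21 ∷ 2 ∷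
  26 ∷ 12 ∷ 7 ∷ 14 ∷ 15 ∷ 8 ∷ 20 ∷ 18 ∷ [])) _

metacyclic39-directed : Fin 39 ⤖ (Fin 13 × Fin 3)
metacyclic39-directed = listing _≟²_ (↔⇒⤖ Fin.*↔×) (metacyclicListing 13 (
  0 ∷ 2 ∷ 31 ∷ 24 ∷ 23 ∷ 18 ∷ 12 ∷ 37 ∷ 29 ∷ 35 ∷ 32 ∷ 14 ∷ 7 ∷ 11 ∷ 15 ∷ 28 ∷ 6 ∷ 1 ∷
  10 ∷ 13 ∷ 4 ∷ 30 ∷ 36 ∷ 26 ∷ 5 ∷ 38 ∷ 25 ∷ 22 ∷ 8 ∷ 33 ∷ 3 ∷ 19 ∷ 20 ∷ 21 ∷ 17 ∷ 34 ∷
  9 ∷ 16 ∷ 27 ∷ [])) _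

-- Finite arithmetic checks for 9 and 13.

∀Fin⇒∀∣ : ∀ {P : ℕ → Set} n .{{_ : NonZero n}} →
         (∀ (d : Fin (suc n)) → toℕ d ∣ n → P (toℕ d)) → ∀ {d} → d ∣ n → P d
∀Fin⇒∀∣ {P} n h {d} d∣n =
  ≡.subst P (Fin.toℕ-fromℕ< d<1+n)
    (h (fromℕ< d<1+n) (≡.subst (_∣ n) (≡.sym (Fin.toℕ-fromℕ< d<1+n)) d∣n))
  where
  d<1+n : d < suc n
  d<1+n = s≤s (∣⇒≤ d∣n)

divisorCases? : ∀ p n → Dec (∀ (d : Fin (suc n)) → toℕ d ∣ n →
  toℕ d ∣ 3 ⊎ toℕ d ≡ p ⊎ toℕ d ≡ n)
divisorCases? p n = Fin.all? λ d → (toℕ d ∣? n) →-dec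
  ((toℕ d ∣? 3) ⊎-dec (toℕ d ℕ.≟ p) ⊎-dec (toℕ d ℕ.≟ n))

cubeRoots? : ∀ p .{{_ : NonZero p}} r₀ → Dec (∀ (r : Fin p) → toℕ r ℕ.^ 3 % p ≡ 1 % p →
  toℕ r % p ≡ 1 % p ⊎ toℕ r % p ≡ r₀ % p ⊎ toℕ r ℕ.^ 2 % p ≡ r₀ % p)
cubeRoots? p r₀ = Fin.all? λ r → (_ ℕ.≟ _) →-dec ((_ ℕ.≟ _) ⊎-dec (_ ℕ.≟ _) ⊎-dec (_ ℕ.≟ _))

-- For p = 9 and r₀ = 4 the premise leaves s in {0, 3, 6}, and the cube exponent is 3t modulo 9. For
-- p = 13 and r₀ = 3 it leaves s = 0, where t = 0 serves.
cubes? : ∀ p .{{_ : NonZero p}} r₀ → Dec (∀ (s : Fin p) → toℕ s * r₀ % p ≡ toℕ s % p →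
  ∃ λ (t : Fin p) → (cubeExponent r₀ (toℕ t) + toℕ s) % p ≡ 0 % p)
cubes? p r₀ = Fin.all? λ s → (_ ℕ.≟ _) →-dec Fin.any? λ t → _ ℕ.≟ _

-- Classification of the non-abelian groups of orders 27 and 39.

module _ (G : Group c ℓ) (enum : HasOrder G 27) (nonAbelian : NonAbelian G) where
  open Group G
  open FiniteGroup G enum

  heisenberg⊎metacyclic :
    (∃ λ φ → IsGroupIsomorphism heisenberg rawGroup φ) ⊎
    (∃ λ φ → IsGroupIsomorphism (metacyclic 9 4) rawGroup φ)
  heisenberg⊎metacyclic = [ inj₁ ∘ exponentThree , inj₂ ]′
    (CyclicOfIndexThree.exponentThree⊎metacyclic G enum nonAbelian ≡.refl
      -- The cube roots of 1 modulo 9 are 1, 4 and 7, and 7² is 4 modulo 9.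
      (∀Fin⇒∀∣ 27 (from-yes (divisorCases? 9 27))) ≡.refl ≡.refl 4
      (from-yes (cubeRoots? 9 4)) (from-yes (cubes? 9 4)))
    where
    exponentThree : (∀ g → g ^ 3 ≈ ε) → ∃ λ φ → IsGroupIsomorphism heisenberg rawGroup φ
    exponentThree g³≈ε =
      let x , y , xy≉yx = noncommutingPair nonAbelian
          open ExponentThree.NonCommuting G g³≈ε x y xy≉yx
      in φ , record
        { isGroupMonomorphism = φ-isGroupMonomorphism
        ; surjective = λ g →
            let i , e = injective⇒surjective ≡.refl
                  (Bijection.injective enum³ ∘ IsGroupMonomorphism.injective φ-isGroupMonomorphism) g
            in Bijection.to enum³ i , λ { ≡.refl → e }
        }

module _ (G : Group c ℓ) (enum : HasOrder G 39) (nonAbelian : NonAbelian G) where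
  open Group G
  open FiniteGroup G enum

  ≅metacyclic : ∃ λ φ → IsGroupIsomorphism (metacyclic 13 3) rawGroup φ
  ≅metacyclic = [ ⊥-elim ∘ exponentThree , id ]′
    (CyclicOfIndexThree.exponentThree⊎metacyclic G enum nonAbelian ≡.refl
      -- The cube roots of 1 modulo 13 are 1, 3 and 9, and 9² is 3 modulo 13.
      (∀Fin⇒∀∣ 39 (from-yes (divisorCases? 13 39))) ≡.refl ≡.refl 3
      (from-yes (cubeRoots? 13 3)) (from-yes (cubes? 13 3)))
    where
    27∤39 : ¬ (27 ∣ 39)
    27∤39 = from-yes (¬? (27 ∣? 39))

    exponentThree : ¬ (∀ g → g ^ 3 ≈ ε)
    exponentThree g³≈ε =
      let x , y , xy≉yx = noncommutingPair nonAbelian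
          open ExponentThree.NonCommuting G g³≈ε x y xy≉yx
          module φ = IsGroupMonomorphism φ-isGroupMonomorphism
          open Bijection enum³ using (to; to⁻; injective; surjective)
      in 27∤39 (Lagrange.order-divides {f = φ ∘ to} (injective ∘ φ.injective) λ i j →
          let u = to i Heisenberg.∙ to j Heisenberg.⁻¹ in
          to⁻ u , trans (sym (trans (φ.∙-homo _ _) (∙-congˡ (φ.⁻¹-homo _))))
            (reflexive (≡.cong φ (≡.sym (proj₂ (surjective u) ≡.refl)))))

-- Terraces in every group isomorphic to one of the models.

module _ (G : Group c ℓ) {φ : Fin 3 × Fin 3 × Fin 3 → Group.Carrier G}
         (φ-iso : IsGroupIsomorphism heisenberg (Group.rawGroup G) φ) where
  open Pullback G φ-iso

  abstract
    heisenberg⇒narcissistic : Σ[ a ∈ Arrangement G 27 ] IsNarcissistic G a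
    heisenberg⇒narcissistic =
      narcissistic Heisenberg._≟_ (Bijection.bijective heisenberg-narcissistic) _

    heisenberg⇒directedHalfAndHalf : Σ[ a ∈ Arrangement G 27 ] IsDirectedHalfAndHalf G a
    heisenberg⇒directedHalfAndHalf =
      directedHalfAndHalf Heisenberg._≟_ (Bijection.bijective heisenberg-directed) _

module _ (G : Group c ℓ) {φ : Fin 9 × Fin 3 → Group.Carrier G}
         (φ-iso : IsGroupIsomorphism (metacyclic 9 4) (Group.rawGroup G) φ) where
  open Pullback G φ-iso

  abstract
    metacyclic27⇒narcissistic : Σ[ a ∈ Arrangement G 27 ] IsNarcissistic G a
    metacyclic27⇒narcissistic =
      narcissistic _≟²_ (Bijection.bijective metacyclic27-narcissistic) _

    metacyclic27⇒directedHalfAndHalf : Σ[ a ∈ Arrangement G 27 ] IsDirectedHalfAndHalf G a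
    metacyclic27⇒directedHalfAndHalf =
      directedHalfAndHalf _≟²_ (Bijection.bijective metacyclic27-directed) _

module _ (G : Group c ℓ) {φ : Fin 13 × Fin 3 → Group.Carrier G}
         (φ-iso : IsGroupIsomorphism (metacyclic 13 3) (Group.rawGroup G) φ) where
  open Pullback G φ-iso

  abstract
    metacyclic39⇒directedHalfAndHalf : Σ[ a ∈ Arrangement G 39 ] IsDirectedHalfAndHalf G a
    metacyclic39⇒directedHalfAndHalf =
      directedHalfAndHalf _≟²_ (Bijection.bijective metacyclic39-directed) _

theorem11 : ∀ {c ℓ} →
    ((G : Group c ℓ) → HasOrder G 27 → NonAbelian G →
    (Σ[ a ∈ Arrangement G 27 ] IsNarcissistic G a) ×
    (Σ[ a ∈ Arrangement G 27 ] IsDirectedHalfAndHalf G a))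
    ×
    ((G : Group c ℓ) → HasOrder G 39 → NonAbelian G →
    Σ[ a ∈ Arrangement G 39 ] IsDirectedHalfAndHalf G a)
theorem11 =
  (λ G enum nonAbelian →
    [ (λ (_ , iso) → heisenberg⇒narcissistic G iso , heisenberg⇒directedHalfAndHalf G iso)
    , (λ (_ , iso) → metacyclic27⇒narcissistic G iso , metacyclic27⇒directedHalfAndHalf G iso)
    ]′ (heisenberg⊎metacyclic G enum nonAbelian)) ,
  (λ G enum nonAbelian → metacyclic39⇒directedHalfAndHalf G (proj₂ (≅metacyclic G enum nonAbelian)))
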